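{- For every natural number $n$, the complete graph $K_n$ satisfies $\mathrm{pdim}(K_n) \leq \left\lceil \dfrac{\sqrt{2n+7}+1}{2} \right\rceil$.
   Context: For $q\in\mathbb{R}^d$ and $1\le i<j\le d$, let $\pi_{i,j}(q)=(q_i,q_j)$ be the projection onto the plane spanned by the $i$-th and $j$-th coordinate axes. Given a graph $G=(V,E)$, an injective map $\pi:V\to\mathbb{R}^d$ is a plane-projecting map of $G$ if there is a decomposition $E=\bigcup_{1\le i<j\le d}E_{i,j}$ such that for every $i<j$, $\pi_{i,j}\circ\pi$ is injective on $V$ and, with edges drawn as straight segments between projected endpoints, gives a straight-line planar embedding of $(V,E_{i,j})$. The plane-projecting dimension $\mathrm{pdim}(G)$ is the smallest $d$ for which a plane-projecting map of $G$ into $\mathbb{R}^d$ exists. -}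

module Defs where

open import Data.Nat as ℕ using (ℕ; _*_; _∸_; _^_)
open import Data.Fin as Fin using (Fin)
open import Data.Rational as ℚ using (ℚ; 0ℚ; 1ℚ)
open import Data.Product using (Σ; ∃; _×_; _,_)
open import Data.Sum using (_⊎_)
open import Relation.Binary.PropositionalEquality using (_≡_; _≢_)
open import Relation.Nullary using (¬_)
open import Level using (0ℓ)
open import Relation.Unary using (Pred)

record Graph (n : ℕ) : Set₁ where
  field
    Adj : Fin n → Fin n → Set

open Graph public

K : (n : ℕ) → Graph n
K n = record { Adj = λ u v → u ≢ v }

Point2 : Set
Point2 = ℚ × ℚ

OnSeg : Point2 → Point2 → Point2 → Set
OnSeg (p₁ , p₂) (a₁ , a₂) (b₁ , b₂) =
  Σ ℚ λ t → (0ℚ ℚ.≤ t) × (t ℚ.≤ 1ℚ) ×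
    (p₁ ≡ a₁ ℚ.+ t ℚ.* (b₁ ℚ.- a₁)) × (p₂ ≡ a₂ ℚ.+ t ℚ.* (b₂ ℚ.- a₂))

SameEdge : {n : ℕ} → Fin n → Fin n → Fin n → Fin n → Set
SameEdge u v x y = ((u ≡ x) × (v ≡ y)) ⊎ ((u ≡ y) × (v ≡ x))

StraightLinePlanar : (n : ℕ) → (Fin n → Point2) → (Fin n → Fin n → Set) → Set
StraightLinePlanar n pos E =
  (∀ u v → pos u ≡ pos v → u ≡ v) ×
  (∀ u v w → E u v → w ≢ u → w ≢ v → ¬ OnSeg (pos w) (pos u) (pos v)) ×
  (∀ u v x y → E u v → E x y → ¬ SameEdge u v x y →
     ∀ p → OnSeg p (pos u) (pos v) → OnSeg p (pos x) (pos y) →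
     ((p ≡ pos u) ⊎ (p ≡ pos v)) × ((p ≡ pos x) ⊎ (p ≡ pos y)))

proj : {d : ℕ} → Fin d → Fin d → (Fin d → ℚ) → Point2
proj i j q = (q i , q j)

IsPlaneProjecting : {n : ℕ} → Graph n → (d : ℕ) → (Fin n → Fin d → ℚ) → Set₁
IsPlaneProjecting {n} G d π =
  Σ (Fin d → Fin d → Fin n → Fin n → Set) λ E' →
    (∀ u v → π u ≡ π v → u ≡ v) ×
    (∀ i j u v → E' i j u v → Adj G u v) ×
    (∀ u v → Adj G u v → Σ (Fin d) λ i → Σ (Fin d) λ j →
        (i Fin.< j) × (E' i j u v ⊎ E' i j v u)) ×
    (∀ i j → i Fin.< j →
        StraightLinePlanar n (λ v → proj i j (π v)) (E' i j))

HasPlaneProjectingMap : {n : ℕ} → Graph n → ℕ → Set₁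
HasPlaneProjectingMap {n} G d = Σ (Fin n → Fin d → ℚ) λ π → IsPlaneProjecting G d π

PdimAtMost : {n : ℕ} → Graph n → ℕ → Set₁
PdimAtMost G D = Σ ℕ λ d → (d ℕ.≤ D) × HasPlaneProjectingMap G d

-- D = ⌈(√(2n+7) + 1)/2⌉, characterised in ℕ:
-- D is the least integer with 2D-1 ≥ √(2n+7), i.e.
-- (2D-1)² ≥ 2n+7 and (2D-3 < 0 or (2D-3)² < 2n+7).
IsCeilBound : ℕ → ℕ → Set
IsCeilBound n D =
  (1 ℕ.≤ D) × (2 * n ℕ.+ 7 ℕ.≤ (2 * D ∸ 1) ^ 2) × ((2 * D ∸ 3) ^ 2 ℕ.< 2 * n ℕ.+ 7)

{-# OPTIONS --safe #-}

-- If K_n can be drawn in the plane with straight edges split into k = D (D - 1) / 2 crossing-free layers, then it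
-- has a plane-projecting map into D-space: send (X , Y) to the point with coordinates X + i Y, so that every
-- coordinate projection is an injective linear image of the drawing. It remains to draw K_4k in k layers.
--
-- Take 2k inner points forming an almost regular polygon, and k antipodal pairs of very distant outer points T, B
-- in directions that separate the directions of the chords of the polygon. In the layer of a pair T, B the inner
-- points, seen from T or B, are ordered by a linear functional that vanishes on the line TB. This layer joins T and
-- B to each other and to all inner points, joins consecutive inner points in that order, joins T to the outer points
-- on one side of TB, and joins B to the outer points on the other side. The path through the inner points is a
-- zigzag consisting of the chords of two adjacent directions, so the k zigzags exhaust all chords; an outer-outer
-- edge lies in the layer of one of its two ends.
--
-- Rational almost regular polygons come from the recurrence S (n + 2) = t S (n + 1) - S n with t slightly less than
-- 2: S behaves like a sine, and the index M of its first sign change plays the role of π.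

module Submission where

open import Defs
open import Data.Nat as ℕ using (ℕ; zero; suc; z≤n; s≤s)
import Data.Nat.DivMod as DivMod
import Data.Nat.Properties as ℕₚ
import Data.Nat.Tactic.RingSolver as ℕ-Solver
open import Data.Fin as Fin using (Fin; toℕ)
import Data.Fin.Properties as Finₚ
open import Data.Product using (Σ; ∃; _×_; _,_; proj₁; proj₂)
open import Data.Product.Properties using (≡-dec)
open import Data.Rational using (ℚ; 0ℚ; 1ℚ; _+_; _*_; _-_; -_; _<_; _≤_; _⊔_; 1/_; positive; nonNegative; ≢-nonZero)
import Data.Rational.Properties as ℚₚ
open import Data.Sum using (_⊎_; inj₁; inj₂; [_,_]′; swap) renaming (map to map-⊎)
open import Function using (_∘_)
open import Relation.Binary using (tri<; tri≈; tri>)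
open import Relation.Binary.PropositionalEquality using (_≡_; _≢_; refl; sym; trans; cong; cong₂; cong-app; subst; subst₂)
open import Relation.Nullary using (¬_; yes; no; contradiction; dec⇒maybe)
open import Tactic.RingSolver using (solve-∀)
open import Tactic.RingSolver.Core.AlmostCommutativeRing using (AlmostCommutativeRing; fromCommutativeRing)

ℚ-ring : AlmostCommutativeRing _ _
ℚ-ring = fromCommutativeRing ℚₚ.+-*-commutativeRing (λ x → dec⇒maybe (0ℚ ℚₚ.≟ x))

-- Ordered-field arithmetic

*-pos : ∀ {a b} → 0ℚ < a → 0ℚ < b → 0ℚ < a * b
*-pos {a} {b} 0<a 0<b = subst (_< a * b) (ℚₚ.*-zeroʳ a) (ℚₚ.*-monoʳ-<-pos a {{positive 0<a}} 0<b)

*-nonNeg : ∀ {a b} → 0ℚ ≤ a → 0ℚ ≤ b → 0ℚ ≤ a * b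
*-nonNeg {a} {b} 0≤a 0≤b = subst (_≤ a * b) (ℚₚ.*-zeroʳ a) (ℚₚ.*-monoˡ-≤-nonNeg a {{nonNegative 0≤a}} 0≤b)

+-pos : ∀ {a b} → 0ℚ < a → 0ℚ < b → 0ℚ < a + b
+-pos = ℚₚ.+-mono-<

+-pos-nonNeg : ∀ {a b} → 0ℚ < a → 0ℚ ≤ b → 0ℚ < a + b
+-pos-nonNeg = ℚₚ.+-mono-<-≤

+-nonNeg : ∀ {a b} → 0ℚ ≤ a → 0ℚ ≤ b → 0ℚ ≤ a + b
+-nonNeg = ℚₚ.+-mono-≤

0<1 : 0ℚ < 1ℚ
0<1 = ℚₚ.positive⁻¹ 1ℚ

0<2 : 0ℚ < 1ℚ + 1ℚ
0<2 = ℚₚ.positive⁻¹ (1ℚ + 1ℚ)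

<⇒0<- : ∀ {a b} → a < b → 0ℚ < b - a
<⇒0<- {a} {b} a<b = subst (_< b - a) (ℚₚ.+-inverseʳ a) (ℚₚ.+-monoˡ-< (- a) a<b)

≤⇒0≤- : ∀ {a b} → a ≤ b → 0ℚ ≤ b - a
≤⇒0≤- {a} {b} a≤b = subst (_≤ b - a) (ℚₚ.+-inverseʳ a) (ℚₚ.+-monoˡ-≤ (- a) a≤b)

<-by-difference : ∀ {a b e} → 0ℚ < e → b ≡ a + e → a < b
<-by-difference {a} {b} 0<e b≡a+e = subst₂ _<_ (ℚₚ.+-identityʳ a) (sym b≡a+e) (ℚₚ.+-monoʳ-< a 0<e)

≤-by-difference : ∀ {a b e} → 0ℚ ≤ e → b ≡ a + e → a ≤ b
≤-by-difference {a} {b} 0≤e b≡a+e = subst₂ _≤_ (ℚₚ.+-identityʳ a) (sym b≡a+e) (ℚₚ.+-monoʳ-≤ a 0≤e)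

<0⇒0<- : ∀ {a} → a < 0ℚ → 0ℚ < - a
<0⇒0<- = ℚₚ.neg-antimono-<

0<-⇒<0 : ∀ {a} → 0ℚ < - a → a < 0ℚ
0<-⇒<0 {a} 0<-a = <-by-difference 0<-a (sym (ℚₚ.+-inverseʳ a))

*-neg-pos : ∀ {a b} → a < 0ℚ → 0ℚ < b → a * b < 0ℚ
*-neg-pos {a} {b} a<0 0<b = 0<-⇒<0 (subst (0ℚ <_) (sym (ℚₚ.neg-distribˡ-* a b)) (*-pos (<0⇒0<- a<0) 0<b))

<⇒≢ : ∀ {a b} → a < b → a ≢ b
<⇒≢ = ℚₚ.<⇒≢

>⇒≢ : ∀ {a b} → b < a → a ≢ b
>⇒≢ b<a = ℚₚ.<⇒≢ b<a ∘ sym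

≢⇒≶ : ∀ {a b} → a ≢ b → (a < b) ⊎ (b < a)
≢⇒≶ {a} {b} a≢b with ℚₚ.<-cmp a b
... | tri< a<b _ _ = inj₁ a<b
... | tri≈ _ a≡b _ = contradiction a≡b a≢b
... | tri> _ _ b<a = inj₂ b<a

*-≢0 : ∀ {a b} → a ≢ 0ℚ → b ≢ 0ℚ → a * b ≢ 0ℚ
*-≢0 {a} {b} a≢0 b≢0 ab≡0 with ≢⇒≶ a≢0 | ≢⇒≶ b≢0
... | inj₁ a<0 | inj₁ b<0 = >⇒≢ (*-pos (<0⇒0<- a<0) (<0⇒0<- b<0)) (trans (neg-*-neg a b) ab≡0)
  where
  neg-*-neg : ∀ a b → - a * - b ≡ a * b
  neg-*-neg = solve-∀ ℚ-ring
... | inj₁ a<0 | inj₂ 0<b = <⇒≢ (*-neg-pos a<0 0<b) ab≡0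
... | inj₂ 0<a | inj₁ b<0 = <⇒≢ (*-neg-pos b<0 0<a) (trans (ℚₚ.*-comm b a) ab≡0)
... | inj₂ 0<a | inj₂ 0<b = >⇒≢ (*-pos 0<a 0<b) ab≡0

*-zero-cancelʳ : ∀ {a b} → b ≢ 0ℚ → a * b ≡ 0ℚ → a ≡ 0ℚ
*-zero-cancelʳ {a} {b} b≢0 ab≡0 with a ℚₚ.≟ 0ℚ
... | yes a≡0 = a≡0
... | no a≢0 = contradiction ab≡0 (*-≢0 a≢0 b≢0)

square-nonNeg : ∀ a → 0ℚ ≤ a * a
square-nonNeg a with ℚₚ.≤-total 0ℚ a
... | inj₁ 0≤a = *-nonNeg 0≤a 0≤a
... | inj₂ a≤0 = subst (0ℚ ≤_) (neg-square a) (*-nonNeg (ℚₚ.neg-antimono-≤ a≤0) (ℚₚ.neg-antimono-≤ a≤0))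
  where
  neg-square : ∀ a → - a * - a ≡ a * a
  neg-square = solve-∀ ℚ-ring

-≡0⇒≡ : ∀ {a b} → a - b ≡ 0ℚ → a ≡ b
-≡0⇒≡ {a} {b} eq = trans (add-back a b) (trans (cong (_+ b) eq) (ℚₚ.+-identityˡ b))
  where
  add-back : ∀ a b → a ≡ (a - b) + b
  add-back = solve-∀ ℚ-ring

-- Segments and affine functionals

lerp : Point2 → Point2 → ℚ → Point2
lerp (x₁ , x₂) (y₁ , y₂) t = (x₁ + t * (y₁ - x₁) , x₂ + t * (y₂ - x₂))

-- Affinity is recorded only along segments: the arguments below evaluate functionals nowhere else.
record Affine (h : Point2 → ℚ) : Set where
  constructor mkAffine
  field
    on-lerp : ∀ x y t → h (lerp x y t) ≡ h x + t * (h y - h x)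

open Affine

-- Unlike OnSeg, this record lets unification recover the three points.
record Between (p x y : Point2) : Set where
  constructor between
  field
    weight   : ℚ
    weight≥0 : 0ℚ ≤ weight
    weight≤1 : weight ≤ 1ℚ
    position : p ≡ lerp x y weight

onSeg⇒between : ∀ {p} x y → OnSeg p x y → Between p x y
onSeg⇒between x y (t , 0≤t , t≤1 , p₁≡ , p₂≡) = between t 0≤t t≤1 (cong₂ _,_ p₁≡ p₂≡)

between-sym : ∀ {p x y} → Between p x y → Between p y x
between-sym {_} {x₁ , x₂} {y₁ , y₂} (between t 0≤t t≤1 p≡) =
  between (1ℚ - t) (≤⇒0≤- t≤1) (≤-by-difference 0≤t (cancel t)) (trans p≡ (cong₂ _,_ (flip x₁ y₁ t) (flip x₂ y₂ t)))
  where
  cancel : ∀ t → 1ℚ ≡ (1ℚ - t) + t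
  cancel = solve-∀ ℚ-ring
  flip : ∀ x y t → x + t * (y - x) ≡ y + (1ℚ - t) * (x - y)
  flip = solve-∀ ℚ-ring

lerp-0 : ∀ x y → lerp x y 0ℚ ≡ x
lerp-0 (x₁ , x₂) (y₁ , y₂) = cong₂ _,_ (at-0 x₁ y₁) (at-0 x₂ y₂)
  where
  at-0 : ∀ x y → x + 0ℚ * (y - x) ≡ x
  at-0 = solve-∀ ℚ-ring

between-left : ∀ x y → Between x x y
between-left x y = between 0ℚ ℚₚ.≤-refl (ℚₚ.<⇒≤ 0<1) (sym (lerp-0 x y))

module _ {h : Point2 → ℚ} (affine : Affine h) where

  value-on-segment : ∀ {p x y} → (s : Between p x y) → h p ≡ h x + Between.weight s * (h y - h x)
  value-on-segment (between t _ _ p≡) = trans (cong h p≡) (on-lerp affine _ _ t)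

  segment-≥ : ∀ {p x y m} → Between p x y → m ≤ h x → m ≤ h y → m ≤ h p
  segment-≥ {x = x} {y} s@(between t 0≤t t≤1 _) m≤hx m≤hy with ℚₚ.≤-total (h x) (h y)
  ... | inj₁ hx≤hy = ℚₚ.≤-trans m≤hx (≤-by-difference (*-nonNeg 0≤t (≤⇒0≤- hx≤hy)) (value-on-segment s))
  ... | inj₂ hy≤hx = ℚₚ.≤-trans m≤hy (≤-by-difference (*-nonNeg (≤⇒0≤- t≤1) (≤⇒0≤- hy≤hx))
                       (trans (value-on-segment s) (flip (h x) (h y) t)))
    where
    flip : ∀ x y t → x + t * (y - x) ≡ y + (1ℚ - t) * (x - y)
    flip = solve-∀ ℚ-ring

  segment-> : ∀ {p x y m} → Between p x y → m < h x → m < h y → m < h p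
  segment-> {x = x} {y} s m<hx m<hy with ℚₚ.≤-total (h x) (h y)
  ... | inj₁ hx≤hy = ℚₚ.<-≤-trans m<hx (segment-≥ s ℚₚ.≤-refl hx≤hy)
  ... | inj₂ hy≤hx = ℚₚ.<-≤-trans m<hy (segment-≥ s hy≤hx ℚₚ.≤-refl)

  -- Along the segment `h` is linear in the weight with nonzero slope, so it takes its value at `x`
  -- only for weight 0.
  segment-at-end : ∀ {p x y} → Between p x y → h p ≡ h x → h y ≢ h x → p ≡ x
  segment-at-end {x = x} {y} s@(between t _ _ p≡) hp≡hx hy≢hx = trans p≡ (trans (cong (lerp x y) t≡0) (lerp-0 x y))
    where
    cancel : ∀ a e → e ≡ (a + e) - a
    cancel = solve-∀ ℚ-ring
    t≡0 : t ≡ 0ℚ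
    t≡0 = *-zero-cancelʳ (hy≢hx ∘ -≡0⇒≡)
      (trans (cancel (h x) _) (trans (cong (_- h x) (trans (sym (value-on-segment s)) hp≡hx)) (ℚₚ.+-inverseʳ (h x))))

neg-affine : ∀ {h} → Affine h → Affine (λ p → - h p)
neg-affine {h} affine = mkAffine λ x y t → trans (cong -_ (on-lerp affine x y t)) (distrib (h x) (h y) t)
  where
  distrib : ∀ x y t → - (x + t * (y - x)) ≡ - x + t * (- y - - x)
  distrib = solve-∀ ℚ-ring

det : Point2 → Point2 → ℚ
det (x₁ , x₂) (y₁ , y₂) = x₁ * y₂ - x₂ * y₁

orient : Point2 → Point2 → Point2 → ℚ
orient (a₁ , a₂) (b₁ , b₂) (p₁ , p₂) = det (b₁ - a₁ , b₂ - a₂) (p₁ - a₁ , p₂ - a₂)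

det-affine : ∀ w → Affine (λ p → det p w)
det-affine (w₁ , w₂) = mkAffine λ (x₁ , x₂) (y₁ , y₂) t → identity x₁ x₂ y₁ y₂ w₁ w₂ t
  where
  identity : ∀ x₁ x₂ y₁ y₂ w₁ w₂ t → (x₁ + t * (y₁ - x₁)) * w₂ - (x₂ + t * (y₂ - x₂)) * w₁
    ≡ (x₁ * w₂ - x₂ * w₁) + t * ((y₁ * w₂ - y₂ * w₁) - (x₁ * w₂ - x₂ * w₁))
  identity = solve-∀ ℚ-ring

orient-affine : ∀ a b → Affine (orient a b)
orient-affine (a₁ , a₂) (b₁ , b₂) = mkAffine λ (x₁ , x₂) (y₁ , y₂) t → identity (b₁ - a₁) (b₂ - a₂) a₁ a₂ x₁ x₂ y₁ y₂ t
  where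
  identity : ∀ d₁ d₂ a₁ a₂ x₁ x₂ y₁ y₂ t →
    d₁ * ((x₂ + t * (y₂ - x₂)) - a₂) - d₂ * ((x₁ + t * (y₁ - x₁)) - a₁)
    ≡ (d₁ * (x₂ - a₂) - d₂ * (x₁ - a₁))
      + t * ((d₁ * (y₂ - a₂) - d₂ * (y₁ - a₁)) - (d₁ * (x₂ - a₂) - d₂ * (x₁ - a₁)))
  identity = solve-∀ ℚ-ring

orient-left : ∀ a b → orient a b a ≡ 0ℚ
orient-left (a₁ , a₂) (b₁ , b₂) = identity a₁ a₂ b₁ b₂
  where
  identity : ∀ a₁ a₂ b₁ b₂ → (b₁ - a₁) * (a₂ - a₂) - (b₂ - a₂) * (a₁ - a₁) ≡ 0ℚ
  identity = solve-∀ ℚ-ring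

orient-right : ∀ a b → orient a b b ≡ 0ℚ
orient-right (a₁ , a₂) (b₁ , b₂) = identity (b₁ - a₁) (b₂ - a₂)
  where
  identity : ∀ d₁ d₂ → d₁ * d₂ - d₂ * d₁ ≡ 0ℚ
  identity = solve-∀ ℚ-ring

-- Certificates for two segments to meet only in common endpoints

Meet : Point2 → Point2 → Point2 → Point2 → Set
Meet a b c d = ∀ {p} → Between p a b → Between p c d → ((p ≡ a) ⊎ (p ≡ b)) × ((p ≡ c) ⊎ (p ≡ d))

meet-sym : ∀ {a b c d} → Meet a b c d → Meet c d a b
meet-sym meet s s′ = let (ab , cd) = meet s′ s in cd , ab

module _ {h : Point2 → ℚ} (affine : Affine h) {a b c d : Point2} where

  vanishes : ∀ {p} → h a ≡ 0ℚ → h b ≡ 0ℚ → Between p a b → h p ≡ 0ℚ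
  vanishes ha≡0 hb≡0 s@(between t _ _ _) =
    trans (value-on-segment affine s) (trans (cong₂ (λ α β → α + t * (β - α)) ha≡0 hb≡0) (zeros t))
    where
    zeros : ∀ t → 0ℚ + t * (0ℚ - 0ℚ) ≡ 0ℚ
    zeros = solve-∀ ℚ-ring

  meet-line-above : h a ≡ 0ℚ → h b ≡ 0ℚ → 0ℚ < h c → 0ℚ < h d → Meet a b c d
  meet-line-above ha≡0 hb≡0 0<hc 0<hd s s′ =
    contradiction (vanishes ha≡0 hb≡0 s) (>⇒≢ (segment-> affine s′ 0<hc 0<hd))

  -- The segment from `c` to `d` touches the line `h = 0` only at `c`, which is an end of the other
  -- segment as well.
  meet-line-touch : h a ≡ 0ℚ → h b ≡ 0ℚ → (c ≡ a) ⊎ (c ≡ b) → h d ≢ 0ℚ → Meet a b c d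
  meet-line-touch ha≡0 hb≡0 c∈ab hd≢0 {p} s s′ = map-⊎ (trans p≡c) (trans p≡c) c∈ab , inj₁ p≡c
    where
    hc≡0 : h c ≡ 0ℚ
    hc≡0 = [ (λ c≡a → trans (cong h c≡a) ha≡0) , (λ c≡b → trans (cong h c≡b) hb≡0) ]′ c∈ab
    p≡c : p ≡ c
    p≡c = segment-at-end affine s′ (trans (vanishes ha≡0 hb≡0 s) (sym hc≡0)) (λ hd≡hc → hd≢0 (trans hd≡hc hc≡0))

  private
    segment-≤0 : ∀ {p} → h a ≡ 0ℚ → h b < 0ℚ → Between p a b → h p ≤ 0ℚ
    segment-≤0 {p} ha≡0 hb<0 s = ≤-by-difference
      (segment-≥ (neg-affine affine) s (ℚₚ.neg-antimono-≤ (ℚₚ.≤-reflexive ha≡0)) (ℚₚ.<⇒≤ (<0⇒0<- hb<0)))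
      (sym (ℚₚ.+-inverseʳ (h p)))

    -- The line `h = 0` weakly separates the segments, so a common point lies on it, and the first
    -- segment touches it only at `a`.
    at-boundary : ∀ {p} → h a ≡ 0ℚ → h b < 0ℚ → 0ℚ ≤ h c → 0ℚ ≤ h d →
                  Between p a b → Between p c d → (h p ≡ 0ℚ) × (p ≡ a)
    at-boundary {p} ha≡0 hb<0 0≤hc 0≤hd s s′ =
      hp≡0 , segment-at-end affine s (trans hp≡0 (sym ha≡0)) (λ hb≡ha → <⇒≢ hb<0 (trans hb≡ha ha≡0))
      where
      hp≡0 : h p ≡ 0ℚ
      hp≡0 = ℚₚ.≤-antisym (segment-≤0 ha≡0 hb<0 s) (segment-≥ affine s′ 0≤hc 0≤hd)

  meet-halves-disjoint : h a ≡ 0ℚ → h b < 0ℚ → 0ℚ < h c → 0ℚ < h d → Meet a b c d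
  meet-halves-disjoint ha≡0 hb<0 0<hc 0<hd s s′ =
    contradiction (ℚₚ.<-≤-trans (segment-> affine s′ 0<hc 0<hd) (segment-≤0 ha≡0 hb<0 s)) (ℚₚ.<-irrefl refl)

  meet-halves-touch : h a ≡ 0ℚ → h b < 0ℚ → c ≡ a → 0ℚ ≤ h d → Meet a b c d
  meet-halves-touch ha≡0 hb<0 refl 0≤hd s s′ =
    let (_ , p≡a) = at-boundary ha≡0 hb<0 (ℚₚ.≤-reflexive (sym ha≡0)) 0≤hd s s′ in inj₁ p≡a , inj₁ p≡a

  -- Each segment touches the separating line only at its own first end, and these two ends differ.
  meet-halves-apart : h a ≡ 0ℚ → h b < 0ℚ → h c ≡ 0ℚ → 0ℚ < h d → c ≢ a → Meet a b c d
  meet-halves-apart ha≡0 hb<0 hc≡0 0<hd c≢a s s′ =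
    let (hp≡0 , p≡a) = at-boundary ha≡0 hb<0 (ℚₚ.≤-reflexive (sym hc≡0)) (ℚₚ.<⇒≤ 0<hd) s s′
        p≡c = segment-at-end affine s′ (trans hp≡0 (sym hc≡0)) (λ hd≡hc → >⇒≢ 0<hd (trans hd≡hc hc≡0))
    in contradiction (trans (sym p≡c) p≡a) c≢a

meet-line-below : ∀ {h} → Affine h → ∀ {a b c d} → h a ≡ 0ℚ → h b ≡ 0ℚ → h c < 0ℚ → h d < 0ℚ → Meet a b c d
meet-line-below affine ha≡0 hb≡0 hc<0 hd<0 =
  meet-line-above (neg-affine affine) (cong -_ ha≡0) (cong -_ hb≡0) (<0⇒0<- hc<0) (<0⇒0<- hd<0)

-- `h` rises along both segments, and its values on the first end no later than those on the second
-- begin. Only a level shared by `b` and `c` can be common.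
meet-levels : ∀ {h} → Affine h → ∀ {a b c d} → h a < h b → h b ≤ h c → h c < h d → (h b ≡ h c → b ≡ c) → Meet a b c d
meet-levels {h} affine {a} {b} {c} {d} ha<hb hb≤hc hc<hd level-injective {p} s s′ = inj₂ (trans p≡c (sym b≡c)) , inj₁ p≡c
  where
  hp≤hb : h p ≤ h b
  hp≤hb = ≤-by-difference
    (≤⇒0≤- (segment-≥ (neg-affine affine) {m = - h b} s (ℚₚ.<⇒≤ (ℚₚ.neg-antimono-< ha<hb)) ℚₚ.≤-refl))
    (cancel (h b) (h p))
    where
    cancel : ∀ b p → b ≡ p + (- p - - b)
    cancel = solve-∀ ℚ-ring
  hc≤hp : h c ≤ h p
  hc≤hp = segment-≥ affine s′ ℚₚ.≤-refl (ℚₚ.<⇒≤ hc<hd)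
  b≡c : b ≡ c
  b≡c = level-injective (ℚₚ.≤-antisym hb≤hc (ℚₚ.≤-trans hc≤hp hp≤hb))
  p≡c : p ≡ c
  p≡c = segment-at-end affine s′ (ℚₚ.≤-antisym (ℚₚ.≤-trans hp≤hb hb≤hc) hc≤hp) (>⇒≢ hc<hd)

-- A line meets a definite conic at most twice

quadratic : ℚ → Point2 → ℚ
quadratic t (x₁ , x₂) = (x₁ * x₁ + x₂ * x₂) - t * (x₁ * x₂)

Definite : ℚ → Set
Definite t = ∀ x → quadratic t x ≡ 0ℚ → x ≡ (0ℚ , 0ℚ)

-- A common point `p` with weights `r` and `r′` on the two chords yields two equations for
-- `u = p - a` that differ only in the weight. So either `u` is a zero of the definite form, hence
-- 0, or `r = r′`, and then `r = 0` or `b = c`.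
meet-chords : ∀ {t} → Definite t → ∀ {a b c} → quadratic t b ≡ quadratic t a → quadratic t c ≡ quadratic t a →
              b ≢ c → Meet a b a c
meet-chords {t} definite {a@(a₁ , a₂)} {b@(b₁ , b₂)} {c@(c₁ , c₂)} qb≡qa qc≡qa b≢c {p@(p₁ , p₂)}
            s@(between r _ _ p≡r) s′@(between r′ _ _ p≡r′) = inj₁ p≡a , inj₁ p≡a
  where
  u : Point2
  u = (p₁ - a₁ , p₂ - a₂)
  -- The derivative of the form at `a`. Multiplying the Taylor expansion of `quadratic t b` around
  -- `a` by `r * r` turns `r * (b - a)` into `u` and gives `chord`.
  polar : Point2 → ℚ
  polar (v₁ , v₂) = ((1ℚ + 1ℚ) * (a₁ * v₁ + a₂ * v₂)) - t * (a₁ * v₂ + a₂ * v₁)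
  chord : ∀ b₁ b₂ r → quadratic t (b₁ , b₂) ≡ quadratic t a → p ≡ lerp a (b₁ , b₂) r → quadratic t u + r * polar u ≡ 0ℚ
  chord b₁ b₂ r qb≡qa refl = trans (expand a₁ a₂ b₁ b₂ r t)
      (trans (cong (λ e → r * r * (e - quadratic t a)) qb≡qa) (cancel r (quadratic t a)))
    where
    expand : ∀ a₁ a₂ b₁ b₂ r t →
      let p₁ = a₁ + r * (b₁ - a₁)
          p₂ = a₂ + r * (b₂ - a₂) in
      (((p₁ - a₁) * (p₁ - a₁) + (p₂ - a₂) * (p₂ - a₂)) - t * ((p₁ - a₁) * (p₂ - a₂)))
        + r * (((1ℚ + 1ℚ) * (a₁ * (p₁ - a₁) + a₂ * (p₂ - a₂))) - t * (a₁ * (p₂ - a₂) + a₂ * (p₁ - a₁)))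
      ≡ r * r * (((b₁ * b₁ + b₂ * b₂) - t * (b₁ * b₂)) - ((a₁ * a₁ + a₂ * a₂) - t * (a₁ * a₂)))
    expand = solve-∀ ℚ-ring
    cancel : ∀ r q → r * r * (q - q) ≡ 0ℚ
    cancel = solve-∀ ℚ-ring
  u≡0⇒p≡a : u ≡ (0ℚ , 0ℚ) → p ≡ a
  u≡0⇒p≡a eq = cong₂ _,_ (-≡0⇒≡ (cong proj₁ eq)) (-≡0⇒≡ (cong proj₂ eq))
  p≡a : p ≡ a
  p≡a with polar u ℚₚ.≟ 0ℚ | r ℚₚ.≟ 0ℚ
  ... | yes polar≡0 | _ = u≡0⇒p≡a (definite u (trans (sym (ℚₚ.+-identityʳ _))
          (trans (cong (quadratic t u +_) (sym (trans (cong (r *_) polar≡0) (ℚₚ.*-zeroʳ r)))) (chord b₁ b₂ r qb≡qa p≡r))))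
  ... | no _ | yes r≡0 = trans p≡r (trans (cong (lerp a b) r≡0) (lerp-0 a b))
  ... | no polar≢0 | no r≢0 = contradiction b≡c b≢c
    where
    subtract : ∀ q r r′ e → (q + r * e) - (q + r′ * e) ≡ (r - r′) * e
    subtract = solve-∀ ℚ-ring
    r≡r′ : r ≡ r′
    r≡r′ = -≡0⇒≡ (*-zero-cancelʳ polar≢0 (trans (sym (subtract (quadratic t u) r r′ (polar u)))
      (cong₂ _-_ (chord b₁ b₂ r qb≡qa p≡r) (chord c₁ c₂ r′ qc≡qa p≡r′))))
    scaled : ∀ a b c r → (a + r * (b - a)) - (a + r * (c - a)) ≡ (b - c) * r
    scaled = solve-∀ ℚ-ring
    coordinate : ∀ a b c → a + r * (b - a) ≡ a + r * (c - a) → b ≡ c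
    coordinate a b c eq = -≡0⇒≡ (*-zero-cancelʳ r≢0 (trans (sym (scaled a b c r))
      (trans (cong (_- (a + r * (c - a))) eq) (ℚₚ.+-inverseʳ (a + r * (c - a))))))
    b≡c : b ≡ c
    b≡c = let same = trans (sym p≡r) (trans p≡r′ (cong (lerp a c) (sym r≡r′))) in
      cong₂ _,_ (coordinate a₁ b₁ c₁ (cong proj₁ same)) (coordinate a₂ b₂ c₂ (cong proj₂ same))

-- The drawing of a single layer

scale : ℚ → Point2 → Point2
scale r (x₁ , x₂) = (r * x₁ , r * x₂)

negate : Point2 → Point2
negate (x₁ , x₂) = (- x₁ , - x₂)

det-scaleˡ : ∀ r x y → det (scale r x) y ≡ r * det x y
det-scaleˡ r (x₁ , x₂) (y₁ , y₂) = identity r x₁ x₂ y₁ y₂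
  where
  identity : ∀ r x₁ x₂ y₁ y₂ → r * x₁ * y₂ - r * x₂ * y₁ ≡ r * (x₁ * y₂ - x₂ * y₁)
  identity = solve-∀ ℚ-ring

det-negateˡ : ∀ x y → det (negate x) y ≡ - det x y
det-negateˡ (x₁ , x₂) (y₁ , y₂) = identity x₁ x₂ y₁ y₂
  where
  identity : ∀ x₁ x₂ y₁ y₂ → - x₁ * y₂ - - x₂ * y₁ ≡ - (x₁ * y₂ - x₂ * y₁)
  identity = solve-∀ ℚ-ring

det-negateʳ : ∀ x y → det x (negate y) ≡ - det x y
det-negateʳ (x₁ , x₂) (y₁ , y₂) = identity x₁ x₂ y₁ y₂
  where
  identity : ∀ x₁ x₂ y₁ y₂ → x₁ * - y₂ - x₂ * - y₁ ≡ - (x₁ * y₂ - x₂ * y₁)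
  identity = solve-∀ ℚ-ring

det-self : ∀ x → det x x ≡ 0ℚ
det-self (x₁ , x₂) = identity x₁ x₂
  where
  identity : ∀ x₁ x₂ → x₁ * x₂ - x₂ * x₁ ≡ 0ℚ
  identity = solve-∀ ℚ-ring

det-antisym : ∀ x y → det x y ≡ - det y x
det-antisym (x₁ , x₂) (y₁ , y₂) = identity x₁ x₂ y₁ y₂
  where
  identity : ∀ x₁ x₂ y₁ y₂ → x₁ * y₂ - x₂ * y₁ ≡ - (y₁ * x₂ - y₂ * x₁)
  identity = solve-∀ ℚ-ring

orient-from-scaled : ∀ r w x y → orient (scale r w) x y ≡ r * (det y w - det x w) + det x y
orient-from-scaled r (w₁ , w₂) (x₁ , x₂) (y₁ , y₂) = identity r w₁ w₂ x₁ x₂ y₁ y₂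
  where
  identity : ∀ r w₁ w₂ x₁ x₂ y₁ y₂ →
    (x₁ - r * w₁) * (y₂ - r * w₂) - (x₂ - r * w₂) * (y₁ - r * w₁)
    ≡ r * ((y₁ * w₂ - y₂ * w₁) - (x₁ * w₂ - x₂ * w₁)) + (x₁ * y₂ - x₂ * y₁)
  identity = solve-∀ ℚ-ring

orient-scaled-scaled : ∀ r w e x → orient (scale r w) (scale r e) x ≡ - (r * (r * det e w - (det e x - det w x)))
orient-scaled-scaled r (w₁ , w₂) (e₁ , e₂) (x₁ , x₂) = identity r w₁ w₂ e₁ e₂ x₁ x₂
  where
  identity : ∀ r w₁ w₂ e₁ e₂ x₁ x₂ →
    (r * e₁ - r * w₁) * (x₂ - r * w₂) - (r * e₂ - r * w₂) * (x₁ - r * w₁)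
    ≡ - (r * (r * (e₁ * w₂ - e₂ * w₁) - ((e₁ * x₂ - e₂ * x₁) - (w₁ * x₂ - w₂ * x₁))))
  identity = solve-∀ ℚ-ring

quadratic-scale : ∀ t r x → quadratic t (scale r x) ≡ r * r * quadratic t x
quadratic-scale t r (x₁ , x₂) = identity t r x₁ x₂
  where
  identity : ∀ t r x₁ x₂ → (r * x₁ * (r * x₁) + r * x₂ * (r * x₂)) - t * (r * x₁ * (r * x₂))
    ≡ r * r * ((x₁ * x₁ + x₂ * x₂) - t * (x₁ * x₂))
  identity = solve-∀ ℚ-ring

quadratic-negate : ∀ t x → quadratic t (negate x) ≡ quadratic t x
quadratic-negate t (x₁ , x₂) = identity t x₁ x₂
  where
  identity : ∀ t x₁ x₂ → (- x₁ * - x₁ + - x₂ * - x₂) - t * (- x₁ * - x₂) ≡ (x₁ * x₁ + x₂ * x₂) - t * (x₁ * x₂)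
  identity = solve-∀ ℚ-ring

-- A straight-line drawing witnessing that the complete graph on `n` vertices has geometric
-- thickness at most `k`. Layers are directed relations, so `complete` asks for an edge in one of
-- the two directions.
record Thickness (k n : ℕ) : Set₁ where
  field
    place       : Fin n → Point2
    Layer       : Fin k → Fin n → Fin n → Set
    irreflexive : ∀ ℓ {u v} → Layer ℓ u v → u ≢ v
    complete    : ∀ u v → u ≢ v → ∃ λ ℓ → Layer ℓ u v ⊎ Layer ℓ v u
    planar      : ∀ ℓ → StraightLinePlanar n place (Layer ℓ)

data Side : Set where
  up down : Side

orientate : Side → Point2 → Point2
orientate up   w = w
orientate down w = negate w

-- `turn` says that the directions rotate by less than a half turn in all, `aside` puts the inner
-- points on one side of every axis. The two `far` hypotheses make `R` large enough for its leading
-- terms to decide the orientations treated below.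
module Layers
  {k m : ℕ} (w : Fin k → Point2) (x : Fin m → Point2) (R t : ℚ)
  (0<R : 0ℚ < R)
  (turn : ∀ {ℓ ℓ′} → ℓ Fin.< ℓ′ → 0ℚ < det (w ℓ′) (w ℓ))
  (aside : ∀ ℓ i → 0ℚ < det (x i) (w ℓ))
  (generic : ∀ ℓ {i j} → i ≢ j → det (x i) (w ℓ) ≢ det (x j) (w ℓ))
  (far-inner : ∀ ℓ i j → det (x i) (w ℓ) < det (x j) (w ℓ) →
     (det (x i) (x j) < R * (det (x j) (w ℓ) - det (x i) (w ℓ))) ×
     (- det (x i) (x j) < R * (det (x j) (w ℓ) - det (x i) (w ℓ))))
  (far-outer : ∀ ℓ s ℓ′ i → 0ℚ < det (orientate s (w ℓ′)) (w ℓ) →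
     det (orientate s (w ℓ′)) (x i) - det (w ℓ) (x i) < R * det (orientate s (w ℓ′)) (w ℓ))
  (definite : Definite t)
  (conic : ∀ ℓ → quadratic t (w ℓ) ≡ 1ℚ)
  where

  data Vertex : Set where
    inner : Fin m → Vertex
    outer : Side → Fin k → Vertex

  pos : Vertex → Point2
  pos (inner i) = x i
  pos (outer s ℓ) = scale R (orientate s (w ℓ))

  -- The `Left` outer points of layer `ℓ` lie on the side of its axis where the inner points are,
  -- the `Right` ones on the other side. Passing to the antipode changes the side, so `up` and
  -- `down` compare indices oppositely.
  Left : Fin k → Side → Fin k → Set
  Left ℓ up   ℓ′ = ℓ Fin.< ℓ′
  Left ℓ down ℓ′ = ℓ′ Fin.< ℓ

  Right : Fin k → Side → Fin k → Set
  Right ℓ up   ℓ′ = ℓ′ Fin.< ℓ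
  Right ℓ down ℓ′ = ℓ Fin.< ℓ′

  level : Fin k → Fin m → ℚ
  level ℓ i = det (x i) (w ℓ)

  data Edge (ℓ : Fin k) : Vertex → Vertex → Set where
    path  : ∀ {i j} → level ℓ i < level ℓ j → (∀ z → (level ℓ z ≤ level ℓ i) ⊎ (level ℓ j ≤ level ℓ z)) →
            Edge ℓ (inner i) (inner j)
    spoke : ∀ s i → Edge ℓ (outer s ℓ) (inner i)
    axis  : Edge ℓ (outer up ℓ) (outer down ℓ)
    left  : ∀ {s ℓ′} → Left ℓ s ℓ′ → Edge ℓ (outer up ℓ) (outer s ℓ′)
    right : ∀ {s ℓ′} → Right ℓ s ℓ′ → Edge ℓ (outer down ℓ) (outer s ℓ′)

  level-injective : ∀ ℓ {i j} → level ℓ i ≡ level ℓ j → i ≡ j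
  level-injective ℓ {i} {j} eq with i Fin.≟ j
  ... | yes i≡j = i≡j
  ... | no i≢j = contradiction eq (generic ℓ i≢j)

  pos-on-axis : ∀ ℓ s → det (pos (outer s ℓ)) (w ℓ) ≡ 0ℚ
  pos-on-axis ℓ s = trans (det-scaleˡ R (orientate s (w ℓ)) (w ℓ)) (trans (cong (R *_) (unscaled s)) (ℚₚ.*-zeroʳ R))
    where
    unscaled : ∀ s → det (orientate s (w ℓ)) (w ℓ) ≡ 0ℚ
    unscaled up   = det-self (w ℓ)
    unscaled down = trans (det-negateˡ (w ℓ) (w ℓ)) (cong -_ (det-self (w ℓ)))

  turn-neg : ∀ {ℓ ℓ′} → ℓ Fin.< ℓ′ → det (w ℓ) (w ℓ′) < 0ℚ
  turn-neg {ℓ} {ℓ′} ℓ<ℓ′ = 0<-⇒<0 (subst (0ℚ <_) (det-antisym (w ℓ′) (w ℓ)) (turn ℓ<ℓ′))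

  left-det : ∀ {ℓ} s {ℓ′} → Left ℓ s ℓ′ → 0ℚ < det (orientate s (w ℓ′)) (w ℓ)
  left-det up   ℓ<ℓ′ = turn ℓ<ℓ′
  left-det {ℓ} down {ℓ′} ℓ′<ℓ = subst (0ℚ <_) (sym (det-negateˡ (w ℓ′) (w ℓ))) (<0⇒0<- (turn-neg ℓ′<ℓ))

  right-det : ∀ {ℓ} s {ℓ′} → Right ℓ s ℓ′ → det (orientate s (w ℓ′)) (w ℓ) < 0ℚ
  right-det up   ℓ′<ℓ = turn-neg ℓ′<ℓ
  right-det {ℓ} down {ℓ′} ℓ<ℓ′ = subst (_< 0ℚ) (sym (det-negateˡ (w ℓ′) (w ℓ))) (ℚₚ.neg-antimono-< (turn ℓ<ℓ′))

  left-pos : ∀ {ℓ} s {ℓ′} → Left ℓ s ℓ′ → 0ℚ < det (pos (outer s ℓ′)) (w ℓ)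
  left-pos s l = subst (0ℚ <_) (sym (det-scaleˡ R (orientate s _) _)) (*-pos 0<R (left-det s l))

  right-neg : ∀ {ℓ} s {ℓ′} → Right ℓ s ℓ′ → det (pos (outer s ℓ′)) (w ℓ) < 0ℚ
  right-neg s r = subst (_< 0ℚ) (sym (trans (det-scaleˡ R (orientate s _) _) (ℚₚ.*-comm R _))) (*-neg-pos (right-det s r) 0<R)

  locate : ∀ ℓ s ℓ′ → (ℓ ≡ ℓ′) ⊎ (Left ℓ s ℓ′ ⊎ Right ℓ s ℓ′)
  locate ℓ s ℓ′ with Finₚ.<-cmp ℓ ℓ′ | s
  ... | tri< ℓ<ℓ′ _ _ | up   = inj₂ (inj₁ ℓ<ℓ′)
  ... | tri< ℓ<ℓ′ _ _ | down = inj₂ (inj₂ ℓ<ℓ′)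
  ... | tri≈ _ ℓ≡ℓ′ _ | _    = inj₁ ℓ≡ℓ′
  ... | tri> _ _ ℓ′<ℓ | up   = inj₂ (inj₂ ℓ′<ℓ)
  ... | tri> _ _ ℓ′<ℓ | down = inj₂ (inj₁ ℓ′<ℓ)

  -- Antipodal points coincide only at the origin, where the form is 0 and not 1.
  up≢down : ∀ ℓ → pos (outer up ℓ) ≢ pos (outer down ℓ)
  up≢down ℓ eq = contradiction (trans (sym (conic ℓ)) (trans (cong (quadratic t) w≡0) (zeros t))) λ ()
    where
    zeros : ∀ t → (0ℚ * 0ℚ + 0ℚ * 0ℚ) - t * (0ℚ * 0ℚ) ≡ 0ℚ
    zeros = solve-∀ ℚ-ring
    double : ∀ r a → (r * a) - (r * - a) ≡ a * ((1ℚ + 1ℚ) * r)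
    double = solve-∀ ℚ-ring
    vanish : ∀ a → R * a ≡ R * - a → a ≡ 0ℚ
    vanish a eq = *-zero-cancelʳ (>⇒≢ (*-pos 0<2 0<R))
      (trans (sym (double R a)) (trans (cong (_- (R * - a)) eq) (ℚₚ.+-inverseʳ (R * - a))))
    w≡0 : w ℓ ≡ (0ℚ , 0ℚ)
    w≡0 = cong₂ _,_ (vanish _ (cong proj₁ eq)) (vanish _ (cong proj₂ eq))

  inner≢outer : ∀ i s ℓ → pos (inner i) ≢ pos (outer s ℓ)
  inner≢outer i s ℓ eq = >⇒≢ (aside ℓ i) (trans (cong (λ p → det p (w ℓ)) eq) (pos-on-axis ℓ s))

  -- The levels of one arbitrary layer tell the inner points apart; the argument `Fin k` provides
  -- that layer. An outer point lies on the axis of its own layer only.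
  pos-injective : Fin k → ∀ u v → pos u ≡ pos v → u ≡ v
  pos-injective ℓ (inner i) (inner j) eq = cong inner (level-injective ℓ (cong (λ p → det p (w ℓ)) eq))
  pos-injective _ (inner i) (outer s ℓ) eq = contradiction eq (inner≢outer i s ℓ)
  pos-injective _ (outer s ℓ) (inner i) eq = contradiction (sym eq) (inner≢outer i s ℓ)
  pos-injective _ (outer s ℓ) (outer s′ ℓ′) eq with locate ℓ s′ ℓ′
  ... | inj₂ (inj₁ l) = contradiction (trans (cong (λ p → det p (w ℓ)) (sym eq)) (pos-on-axis ℓ s)) (>⇒≢ (left-pos s′ l))
  ... | inj₂ (inj₂ r) = contradiction (trans (cong (λ p → det p (w ℓ)) (sym eq)) (pos-on-axis ℓ s)) (<⇒≢ (right-neg s′ r))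
  ... | inj₁ refl with s | s′
  ... | up   | up   = refl
  ... | down | down = refl
  ... | up   | down = contradiction eq (up≢down ℓ)
  ... | down | up   = contradiction (sym eq) (up≢down ℓ)

  -- Signs of the inner points with respect to the line through an outer and an inner point: seen from the far
  -- outer point, the inner points are ordered by their level.

  up-after : ∀ {ℓ i j} → level ℓ i < level ℓ j → 0ℚ < orient (pos (outer up ℓ)) (x i) (x j)
  up-after {ℓ} {i} {j} i<j = subst (0ℚ <_) (sym (trans (orient-from-scaled R (w ℓ) (x i) (x j))
        (rearrange (R * (level ℓ j - level ℓ i)) (det (x i) (x j)))))
      (<⇒0<- (proj₂ (far-inner ℓ i j i<j)))
    where
    rearrange : ∀ a d → a + d ≡ a - - d
    rearrange = solve-∀ ℚ-ring

  up-before : ∀ {ℓ i j} → level ℓ j < level ℓ i → orient (pos (outer up ℓ)) (x i) (x j) < 0ℚ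
  up-before {ℓ} {i} {j} j<i = 0<-⇒<0 (subst (0ℚ <_)
      (trans (rearrange R (level ℓ i) (level ℓ j) (det (x j) (x i)))
        (cong -_ (trans (cong (R * (level ℓ j - level ℓ i) +_) (sym (det-antisym (x i) (x j))))
          (sym (orient-from-scaled R (w ℓ) (x i) (x j))))))
      (<⇒0<- (proj₂ (far-inner ℓ j i j<i))))
    where
    rearrange : ∀ r a b d → r * (a - b) - - d ≡ - (r * (b - a) + - d)
    rearrange = solve-∀ ℚ-ring

  down-expand : ∀ ℓ i j → orient (pos (outer down ℓ)) (x i) (x j) ≡ R * (- level ℓ j - - level ℓ i) + det (x i) (x j)
  down-expand ℓ i j = trans (orient-from-scaled R (negate (w ℓ)) (x i) (x j))
    (cong₂ (λ a b → R * (a - b) + det (x i) (x j)) (det-negateʳ (x j) (w ℓ)) (det-negateʳ (x i) (w ℓ)))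

  down-after : ∀ {ℓ i j} → level ℓ i < level ℓ j → orient (pos (outer down ℓ)) (x i) (x j) < 0ℚ
  down-after {ℓ} {i} {j} i<j = 0<-⇒<0 (subst (0ℚ <_)
      (trans (rearrange R (level ℓ i) (level ℓ j) _) (cong -_ (sym (down-expand ℓ i j))))
      (<⇒0<- (proj₁ (far-inner ℓ i j i<j))))
    where
    rearrange : ∀ r a b d → r * (b - a) - d ≡ - (r * (- b - - a) + d)
    rearrange = solve-∀ ℚ-ring

  down-before : ∀ {ℓ i j} → level ℓ j < level ℓ i → 0ℚ < orient (pos (outer down ℓ)) (x i) (x j)
  down-before {ℓ} {i} {j} j<i = subst (0ℚ <_)
      (trans (rearrange R (level ℓ i) (level ℓ j) _)
        (trans (cong (R * (- level ℓ j - - level ℓ i) +_) (sym (det-antisym (x i) (x j)))) (sym (down-expand ℓ i j))))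
      (<⇒0<- (proj₁ (far-inner ℓ j i j<i)))
    where
    rearrange : ∀ r a b d → r * (a - b) - d ≡ r * (- b - - a) + - d
    rearrange = solve-∀ ℚ-ring

  spoke-opposite-up : ∀ ℓ i → orient (pos (outer up ℓ)) (x i) (pos (outer down ℓ)) < 0ℚ
  spoke-opposite-up ℓ i = 0<-⇒<0 (subst (0ℚ <_) (sym (identity R (proj₁ (w ℓ)) (proj₂ (w ℓ)) (proj₁ (x i)) (proj₂ (x i))))
      (*-pos (*-pos 0<2 0<R) (aside ℓ i)))
    where
    identity : ∀ r w₁ w₂ x₁ x₂ → - ((x₁ - r * w₁) * (r * - w₂ - r * w₂) - (x₂ - r * w₂) * (r * - w₁ - r * w₁))
      ≡ (1ℚ + 1ℚ) * r * (x₁ * w₂ - x₂ * w₁)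
    identity = solve-∀ ℚ-ring

  spoke-opposite-down : ∀ ℓ i → 0ℚ < orient (pos (outer down ℓ)) (x i) (pos (outer up ℓ))
  spoke-opposite-down ℓ i = subst (0ℚ <_) (sym (identity R (proj₁ (w ℓ)) (proj₂ (w ℓ)) (proj₁ (x i)) (proj₂ (x i))))
      (*-pos (*-pos 0<2 0<R) (aside ℓ i))
    where
    identity : ∀ r w₁ w₂ x₁ x₂ → (x₁ - r * - w₁) * (r * w₂ - r * - w₂) - (x₂ - r * - w₂) * (r * w₁ - r * - w₁)
      ≡ (1ℚ + 1ℚ) * r * (x₁ * w₂ - x₂ * w₁)
    identity = solve-∀ ℚ-ring

  -- An edge between distant points passes outside all inner points: by `far-outer` the term
  -- quadratic in `R` decides the sign.
  left-inner : ∀ {ℓ} s {ℓ′} → Left ℓ s ℓ′ → ∀ i → orient (pos (outer up ℓ)) (pos (outer s ℓ′)) (x i) < 0ℚ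
  left-inner {ℓ} s {ℓ′} l i = subst (_< 0ℚ) (sym (orient-scaled-scaled R (w ℓ) (orientate s (w ℓ′)) (x i)))
    (ℚₚ.neg-antimono-< (*-pos 0<R (<⇒0<- (far-outer ℓ s ℓ′ i (left-det s l)))))

  left-opposite : ∀ {ℓ} s {ℓ′} → Left ℓ s ℓ′ → orient (pos (outer up ℓ)) (pos (outer s ℓ′)) (pos (outer down ℓ)) < 0ℚ
  left-opposite {ℓ} s {ℓ′} l = 0<-⇒<0 (subst (0ℚ <_)
      (sym (identity R (proj₁ (w ℓ)) (proj₂ (w ℓ)) (proj₁ (orientate s (w ℓ′))) (proj₂ (orientate s (w ℓ′)))))
      (*-pos (*-pos (*-pos 0<2 0<R) 0<R) (left-det s l)))
    where
    identity : ∀ r w₁ w₂ e₁ e₂ → - ((r * e₁ - r * w₁) * (r * - w₂ - r * w₂) - (r * e₂ - r * w₂) * (r * - w₁ - r * w₁))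
      ≡ (1ℚ + 1ℚ) * r * r * (e₁ * w₂ - e₂ * w₁)
    identity = solve-∀ ℚ-ring

  quadratic-outer : ∀ s ℓ → quadratic t (pos (outer s ℓ)) ≡ R * R
  quadratic-outer s ℓ = trans (quadratic-scale t R (orientate s (w ℓ)))
    (trans (cong (R * R *_) (trans (unsigned s) (conic ℓ))) (ℚₚ.*-identityʳ (R * R)))
    where
    unsigned : ∀ s → quadratic t (orientate s (w ℓ)) ≡ quadratic t (w ℓ)
    unsigned up   = refl
    unsigned down = quadratic-negate t (w ℓ)

  -- Pairwise comparison of the edges of one layer

  Same : Vertex → Vertex → Vertex → Vertex → Set
  Same u v y z = ((u ≡ y) × (v ≡ z)) ⊎ ((u ≡ z) × (v ≡ y))

  -- Planarity exempts an edge compared with itself, where `Meet` fails; hence the first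
  -- alternative.
  Good : Vertex → Vertex → Vertex → Vertex → Set
  Good u v y z = Same u v y z ⊎ Meet (pos u) (pos v) (pos y) (pos z)

  good-sym : ∀ {u v y z} → Good u v y z → Good y z u v
  good-sym {u} {v} {y} {z} (inj₁ (inj₁ (refl , refl))) = inj₁ (inj₁ (refl , refl))
  good-sym {u} {v} {y} {z} (inj₁ (inj₂ (refl , refl))) = inj₁ (inj₂ (refl , refl))
  good-sym (inj₂ meet) = inj₂ (meet-sym meet)

  across : ∀ ℓ → Affine (λ p → det p (w ℓ))
  across ℓ = det-affine (w ℓ)

  module _ (ℓ : Fin k) where

    private
      T B : Point2
      T = pos (outer up ℓ)
      B = pos (outer down ℓ)

    spoke-order : ∀ s {i j} → i ≢ j → (orient (pos (outer s ℓ)) (x i) (x j) ≢ 0ℚ)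
    spoke-order s i≢j with ≢⇒≶ (generic ℓ i≢j) | s
    ... | inj₁ i<j | up   = >⇒≢ (up-after i<j)
    ... | inj₁ i<j | down = <⇒≢ (down-after i<j)
    ... | inj₂ j<i | up   = <⇒≢ (up-before j<i)
    ... | inj₂ j<i | down = >⇒≢ (down-before j<i)

    same-side : ∀ s {z i j} →
      ((level ℓ z < level ℓ i) × (level ℓ z < level ℓ j)) ⊎ ((level ℓ i < level ℓ z) × (level ℓ j < level ℓ z)) →
      Meet (pos (outer s ℓ)) (x z) (x i) (x j)
    same-side up {z} (inj₁ (zi , zj)) = meet-line-above (orient-affine T (x z)) (orient-left T (x z)) (orient-right T (x z))
      (up-after zi) (up-after zj)
    same-side up {z} (inj₂ (iz , jz)) = meet-line-below (orient-affine T (x z)) (orient-left T (x z)) (orient-right T (x z))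
      (up-before iz) (up-before jz)
    same-side down {z} (inj₁ (zi , zj)) = meet-line-below (orient-affine B (x z)) (orient-left B (x z)) (orient-right B (x z))
      (down-after zi) (down-after zj)
    same-side down {z} (inj₂ (iz , jz)) = meet-line-above (orient-affine B (x z)) (orient-left B (x z)) (orient-right B (x z))
      (down-before iz) (down-before jz)

    neighbours : ∀ {i j} → i ≢ j →
      (∀ z → z ≢ i → z ≢ j →
        ((level ℓ z < level ℓ i) × (level ℓ z < level ℓ j)) ⊎ ((level ℓ i < level ℓ z) × (level ℓ j < level ℓ z))) →
      Edge ℓ (inner i) (inner j) ⊎ Edge ℓ (inner j) (inner i)
    neighbours {i} {j} i≢j beside = map-⊎ (λ i<j → path i<j gap) (λ j<i → path j<i gap′) (≢⇒≶ (generic ℓ i≢j))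
      where
      gap : ∀ z → (level ℓ z ≤ level ℓ i) ⊎ (level ℓ j ≤ level ℓ z)
      gap z with z Fin.≟ i | z Fin.≟ j
      ... | yes refl | _ = inj₁ ℚₚ.≤-refl
      ... | no _ | yes refl = inj₂ ℚₚ.≤-refl
      ... | no z≢i | no z≢j = map-⊎ (ℚₚ.<⇒≤ ∘ proj₁) (ℚₚ.<⇒≤ ∘ proj₂) (beside z z≢i z≢j)
      gap′ : ∀ z → (level ℓ z ≤ level ℓ j) ⊎ (level ℓ i ≤ level ℓ z)
      gap′ z with z Fin.≟ i | z Fin.≟ j
      ... | yes refl | _ = inj₂ ℚₚ.≤-refl
      ... | no _ | yes refl = inj₁ ℚₚ.≤-refl
      ... | no z≢i | no z≢j = map-⊎ (ℚₚ.<⇒≤ ∘ proj₂) (ℚₚ.<⇒≤ ∘ proj₁) (beside z z≢i z≢j)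

    level-≤⇒< : ∀ {i j} → i ≢ j → level ℓ i ≤ level ℓ j → level ℓ i < level ℓ j
    level-≤⇒< i≢j i≤j with ≢⇒≶ (generic ℓ i≢j)
    ... | inj₁ i<j = i<j
    ... | inj₂ j<i = contradiction (ℚₚ.<-≤-trans j<i i≤j) (ℚₚ.<-irrefl refl)

    -- No level lies strictly inside the level interval of a path edge, so two such intervals
    -- coincide or follow one another.
    path-path : ∀ {i j i′ j′} → Edge ℓ (inner i) (inner j) → Edge ℓ (inner i′) (inner j′) →
                Good (inner i) (inner j) (inner i′) (inner j′)
    path-path {i} {j} {i′} {j′} (path i<j gap) (path i′<j′ gap′) with ℚₚ.<-cmp (level ℓ i) (level ℓ i′)
    ... | tri< i<i′ _ _ with gap i′
    ...   | inj₁ i′≤i = contradiction (ℚₚ.<-≤-trans i<i′ i′≤i) (ℚₚ.<-irrefl refl)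
    ...   | inj₂ j≤i′ = inj₂ (meet-levels (across ℓ) i<j j≤i′ i′<j′ (cong x ∘ level-injective ℓ))
    path-path {i} {j} {i′} {j′} (path i<j gap) (path i′<j′ gap′) | tri> _ _ i′<i with gap′ i
    ...   | inj₁ i≤i′ = contradiction (ℚₚ.<-≤-trans i′<i i≤i′) (ℚₚ.<-irrefl refl)
    ...   | inj₂ j′≤i = inj₂ (meet-sym (meet-levels (across ℓ) i′<j′ j′≤i i<j (cong x ∘ level-injective ℓ)))
    path-path {i} {j} {i′} {j′} (path i<j gap) (path i′<j′ gap′) | tri≈ _ i≡i′ _ with gap j′ | gap′ j
    ...   | inj₁ j′≤i | _ = contradiction (ℚₚ.<-≤-trans i′<j′ (subst (level ℓ j′ ≤_) i≡i′ j′≤i)) (ℚₚ.<-irrefl refl)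
    ...   | inj₂ _ | inj₁ j≤i′ = contradiction (ℚₚ.<-≤-trans i<j (subst (level ℓ j ≤_) (sym i≡i′) j≤i′)) (ℚₚ.<-irrefl refl)
    ...   | inj₂ j≤j′ | inj₂ j′≤j = inj₁ (inj₁ (cong inner (level-injective ℓ i≡i′) ,
            cong inner (level-injective ℓ (ℚₚ.≤-antisym j≤j′ j′≤j))))

    -- Unless `z` is an end of the path edge, its level lies outside the interval of that edge, so
    -- from the outer point both ends are seen on the same side of `x z`.
    spoke-path : ∀ s z {i j} → Edge ℓ (inner i) (inner j) → Good (outer s ℓ) (inner z) (inner i) (inner j)
    spoke-path s z {i} {j} (path i<j gap) with z Fin.≟ i | z Fin.≟ j
    ... | yes refl | _ = inj₂ (meet-line-touch (orient-affine S (x i)) (orient-left S (x i)) (orient-right S (x i))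
            (inj₂ refl) (spoke-order s (λ { refl → ℚₚ.<-irrefl refl i<j })))
      where
      S : Point2
      S = pos (outer s ℓ)
    ... | no _ | yes refl = inj₂ (λ s₁ s₂ → let (l , r) = touch s₁ (between-sym s₂) in l , swap r)
      where
      S : Point2
      S = pos (outer s ℓ)
      touch : Meet S (x j) (x j) (x i)
      touch = meet-line-touch (orient-affine S (x j)) (orient-left S (x j)) (orient-right S (x j))
            (inj₂ refl) (spoke-order s (λ { refl → ℚₚ.<-irrefl refl i<j }))
    ... | no z≢i | no z≢j with gap z
    ...   | inj₁ z≤i = inj₂ (same-side s (inj₁ (level-≤⇒< z≢i z≤i , ℚₚ.<-trans (level-≤⇒< z≢i z≤i) i<j)))
    ...   | inj₂ j≤z = inj₂ (same-side s (inj₂ (ℚₚ.<-trans i<j (level-≤⇒< (z≢j ∘ sym) j≤z) , level-≤⇒< (z≢j ∘ sym) j≤z)))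

    spoke-spoke-same : ∀ s i j → Good (outer s ℓ) (inner i) (outer s ℓ) (inner j)
    spoke-spoke-same s i j with i Fin.≟ j
    ... | yes refl = inj₁ (inj₁ (refl , refl))
    ... | no i≢j = inj₂ (meet-line-touch (orient-affine S (x i)) (orient-left S (x i)) (orient-right S (x i))
            (inj₁ refl) (spoke-order s i≢j))
      where
      S : Point2
      S = pos (outer s ℓ)

    -- For distinct `i` and `j` the line through one of the two spokes has the other spoke strictly
    -- on one side; the order of the levels tells which line to take.
    spoke-spoke-opposite : ∀ i j → Good (outer up ℓ) (inner i) (outer down ℓ) (inner j)
    spoke-spoke-opposite i j with i Fin.≟ j
    ... | yes refl = inj₂ (λ s₁ s₂ → let (l , r) = touch s₁ (between-sym s₂) in l , swap r)
      where
      touch : Meet T (x i) (x i) B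
      touch = meet-line-touch (orient-affine T (x i)) (orient-left T (x i)) (orient-right T (x i))
            (inj₂ refl) (<⇒≢ (spoke-opposite-up ℓ i))
    ... | no i≢j with ≢⇒≶ (generic ℓ i≢j)
    ...   | inj₂ j<i = inj₂ (meet-line-below (orient-affine T (x i)) (orient-left T (x i)) (orient-right T (x i))
              (spoke-opposite-up ℓ i) (up-before j<i))
    ...   | inj₁ i<j = inj₂ (meet-sym (meet-line-above (orient-affine B (x j)) (orient-left B (x j)) (orient-right B (x j))
              (spoke-opposite-down ℓ j) (down-before i<j)))

    axis-path : ∀ i j → Good (outer up ℓ) (outer down ℓ) (inner i) (inner j)
    axis-path i j = inj₂ (meet-line-above (across ℓ) (pos-on-axis ℓ up) (pos-on-axis ℓ down) (aside ℓ i) (aside ℓ j))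

    axis-spoke : ∀ s i → Good (outer up ℓ) (outer down ℓ) (outer s ℓ) (inner i)
    axis-spoke s i = inj₂ (meet-line-touch (across ℓ) (pos-on-axis ℓ up) (pos-on-axis ℓ down) (end s) (>⇒≢ (aside ℓ i)))
      where
      end : ∀ s → (pos (outer s ℓ) ≡ T) ⊎ (pos (outer s ℓ) ≡ B)
      end up   = inj₁ refl
      end down = inj₂ refl

    module _ {s ℓ′} (l : Left ℓ s ℓ′) where

      private
        O : Point2
        O = pos (outer s ℓ′)

      -- The line through `T` and `O` has all inner points and `B` strictly on one side, which
      -- settles this case and the next two.
      left-path : ∀ i j → Good (outer up ℓ) (outer s ℓ′) (inner i) (inner j)
      left-path i j = inj₂ (meet-line-below (orient-affine T O) (orient-left T O) (orient-right T O)
        (left-inner s l i) (left-inner s l j))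

      left-spoke : ∀ s′ i → Good (outer up ℓ) (outer s ℓ′) (outer s′ ℓ) (inner i)
      left-spoke up   i = inj₂ (meet-line-touch (orient-affine T O) (orient-left T O) (orient-right T O)
        (inj₁ refl) (<⇒≢ (left-inner s l i)))
      left-spoke down i = inj₂ (meet-line-below (orient-affine T O) (orient-left T O) (orient-right T O)
        (left-opposite s l) (left-inner s l i))

      left-axis : Good (outer up ℓ) (outer s ℓ′) (outer up ℓ) (outer down ℓ)
      left-axis = inj₂ (meet-line-touch (orient-affine T O) (orient-left T O) (orient-right T O)
        (inj₁ refl) (<⇒≢ (left-opposite s l)))

    -- All outer points lie on the conic where the form is `R * R`, so these edges are chords from a
    -- common point.
    fan : ∀ s₀ s ℓ′ s′ ℓ″ → Good (outer s₀ ℓ) (outer s ℓ′) (outer s₀ ℓ) (outer s′ ℓ″)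
    fan s₀ s ℓ′ s′ ℓ″ with ≡-dec ℚₚ._≟_ ℚₚ._≟_ (pos (outer s ℓ′)) (pos (outer s′ ℓ″))
    ... | yes eq = inj₁ (inj₁ (refl , pos-injective ℓ _ _ eq))
    ... | no ne = inj₂ (meet-chords {t} definite (trans (quadratic-outer s ℓ′) (sym (quadratic-outer s₀ ℓ)))
                    (trans (quadratic-outer s′ ℓ″) (sym (quadratic-outer s₀ ℓ))) ne)

    module _ {s ℓ′} (r : Right ℓ s ℓ′) where

      -- The edge leaves the axis at `B` into the open half-plane without inner points, while every
      -- edge of another kind stays in the opposite closed half-plane. This settles all cases below.
      right-path : ∀ i j → Good (outer down ℓ) (outer s ℓ′) (inner i) (inner j)
      right-path i j = inj₂ (meet-halves-disjoint (across ℓ) (pos-on-axis ℓ down) (right-neg s r) (aside ℓ i) (aside ℓ j))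

      right-spoke : ∀ s′ i → Good (outer down ℓ) (outer s ℓ′) (outer s′ ℓ) (inner i)
      right-spoke up   i = inj₂ (meet-halves-apart (across ℓ) (pos-on-axis ℓ down) (right-neg s r)
        (pos-on-axis ℓ up) (aside ℓ i) (up≢down ℓ))
      right-spoke down i = inj₂ (meet-halves-touch (across ℓ) (pos-on-axis ℓ down) (right-neg s r) refl (ℚₚ.<⇒≤ (aside ℓ i)))

      right-axis : Good (outer down ℓ) (outer s ℓ′) (outer up ℓ) (outer down ℓ)
      right-axis = inj₂ (λ s₁ s₂ → let (a , b) = touch s₁ (between-sym s₂) in a , swap b)
        where
        touch : Meet B (pos (outer s ℓ′)) B T
        touch = meet-halves-touch (across ℓ) (pos-on-axis ℓ down) (right-neg s r) refl (ℚₚ.≤-reflexive (sym (pos-on-axis ℓ up)))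

      right-left : ∀ {s′ ℓ″} → Left ℓ s′ ℓ″ → Good (outer down ℓ) (outer s ℓ′) (outer up ℓ) (outer s′ ℓ″)
      right-left {s′} l = inj₂ (meet-halves-apart (across ℓ) (pos-on-axis ℓ down) (right-neg s r)
        (pos-on-axis ℓ up) (left-pos s′ l) (up≢down ℓ))

    good : ∀ {u v y z} → Edge ℓ u v → Edge ℓ y z → Good u v y z
    good e@(path _ _) e′@(path _ _) = path-path e e′
    good e@(path _ _) (spoke s z) = good-sym (spoke-path s z e)
    good (path _ _) axis = good-sym (axis-path _ _)
    good (path _ _) (left l) = good-sym (left-path l _ _)
    good (path _ _) (right r) = good-sym (right-path r _ _)
    good (spoke s z) e@(path _ _) = spoke-path s z e
    good (spoke up i) (spoke up j) = spoke-spoke-same up i j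
    good (spoke up i) (spoke down j) = spoke-spoke-opposite i j
    good (spoke down i) (spoke up j) = good-sym (spoke-spoke-opposite j i)
    good (spoke down i) (spoke down j) = spoke-spoke-same down i j
    good (spoke s i) axis = good-sym (axis-spoke s i)
    good (spoke s i) (left l) = good-sym (left-spoke l s i)
    good (spoke s i) (right r) = good-sym (right-spoke r s i)
    good axis (path _ _) = axis-path _ _
    good axis (spoke s i) = axis-spoke s i
    good axis axis = inj₁ (inj₁ (refl , refl))
    good axis (left l) = good-sym (left-axis l)
    good axis (right r) = good-sym (right-axis r)
    good (left l) (path _ _) = left-path l _ _
    good (left l) (spoke s i) = left-spoke l s i
    good (left l) axis = left-axis l
    good (left _) (left _) = fan up _ _ _ _
    good (left l) (right r) = good-sym (right-left r l)
    good (right r) (path _ _) = right-path r _ _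
    good (right r) (spoke s i) = right-spoke r s i
    good (right r) axis = right-axis r
    good (right r) (left l) = right-left r l
    good (right _) (right _) = fan down _ _ _ _

    -- Each layer reaches all vertices. So a foreign vertex on an edge would be the end of a second
    -- edge that meets the first improperly, and the vertex condition of planarity follows from the
    -- crossing condition.
    incident : ∀ v → ∃ λ y → Edge ℓ y v ⊎ Edge ℓ v y
    incident (inner i) = outer up ℓ , inj₁ (spoke up i)
    incident (outer s ℓ′) with locate ℓ s ℓ′
    ... | inj₂ (inj₁ l) = outer up ℓ , inj₁ (left l)
    ... | inj₂ (inj₂ r) = outer down ℓ , inj₁ (right r)
    ... | inj₁ refl with s
    ...   | up   = outer down ℓ , inj₂ axis
    ...   | down = outer up ℓ , inj₁ axis

    edge-irreflexive : ∀ {u v} → Edge ℓ u v → u ≢ v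
    edge-irreflexive (path i<j _) refl = ℚₚ.<-irrefl refl i<j
    edge-irreflexive (left {up} ℓ<ℓ) refl = Finₚ.<-irrefl refl ℓ<ℓ
    edge-irreflexive (right {down} ℓ<ℓ) refl = Finₚ.<-irrefl refl ℓ<ℓ

    end-off-edge : ∀ {u v v′ y} → Good u v v′ y → v′ ≢ u → v′ ≢ v → ¬ Between (pos v′) (pos u) (pos v)
    end-off-edge (inj₁ (inj₁ (u≡v′ , _))) v′≢u _ _ = v′≢u (sym u≡v′)
    end-off-edge (inj₁ (inj₂ (_ , v≡v′))) _ v′≢v _ = v′≢v (sym v≡v′)
    end-off-edge {u} {v} {v′} {y} (inj₂ meet) v′≢u v′≢v s =
      [ v′≢u ∘ pos-injective ℓ v′ u , v′≢v ∘ pos-injective ℓ v′ v ]′ (proj₁ (meet s (between-left (pos v′) (pos y))))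

    good-flip : ∀ {u v y z} → Good u v y z → Good u v z y
    good-flip (inj₁ same) = inj₁ (swap same)
    good-flip (inj₂ meet) = inj₂ (λ s s′ → let (ab , cd) = meet s (between-sym s′) in ab , swap cd)

    vertex-off-edge : ∀ {u v} v′ → Edge ℓ u v → v′ ≢ u → v′ ≢ v → ¬ Between (pos v′) (pos u) (pos v)
    vertex-off-edge v′ e = end-off-edge (proj₂ (neighbour (incident v′)))
      where
      neighbour : (∃ λ y → Edge ℓ y v′ ⊎ Edge ℓ v′ y) → ∃ λ y → Good _ _ v′ y
      neighbour (y , inj₁ e′) = y , good-flip (good e e′)
      neighbour (y , inj₂ e′) = y , good e e′

    layer-planar : ∀ {n} (vertex : Fin n → Vertex) → (∀ {a b} → vertex a ≡ vertex b → a ≡ b) →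
      StraightLinePlanar n (pos ∘ vertex) (λ a b → Edge ℓ (vertex a) (vertex b))
    layer-planar vertex vertex-injective =
        (λ a b eq → vertex-injective (pos-injective ℓ _ _ eq))
      , (λ a b c e c≢a c≢b on → vertex-off-edge (vertex c) e (c≢a ∘ vertex-injective) (c≢b ∘ vertex-injective)
                                  (onSeg⇒between (pos (vertex a)) (pos (vertex b)) on))
      , (λ a b c d e e′ different p s s′ → crossing-free (good e e′) different
           (onSeg⇒between (pos (vertex a)) (pos (vertex b)) s) (onSeg⇒between (pos (vertex c)) (pos (vertex d)) s′))
      where
      crossing-free : ∀ {a b c d} → Good (vertex a) (vertex b) (vertex c) (vertex d) → ¬ SameEdge a b c d →
        Meet (pos (vertex a)) (pos (vertex b)) (pos (vertex c)) (pos (vertex d))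
      crossing-free (inj₁ (inj₁ (a≡c , b≡d))) different =
          contradiction (inj₁ (vertex-injective a≡c , vertex-injective b≡d)) different
      crossing-free (inj₁ (inj₂ (a≡d , b≡c))) different =
          contradiction (inj₂ (vertex-injective a≡d , vertex-injective b≡c)) different
      crossing-free (inj₂ meet) _ = meet

  -- Every pair of vertices is joined in some layer

  Joined : Vertex → Vertex → Set
  Joined u v = ∃ λ ℓ → Edge ℓ u v ⊎ Edge ℓ v u

  joined-sym : ∀ {u v} → Joined u v → Joined v u
  joined-sym (ℓ , e) = ℓ , swap e

  -- Layer `ℓ` joins a point of `ℓ′` to its own end with the same `Side`, layer `ℓ′` joins a point
  -- of `ℓ` to its own end with the opposite `Side`, so one of the two contains the edge.
  joined-outer : ∀ s s′ {ℓ ℓ′} → ℓ Fin.< ℓ′ → Joined (outer s ℓ) (outer s′ ℓ′)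
  joined-outer up   up   {ℓ}      ℓ<ℓ′ = ℓ , inj₁ (left ℓ<ℓ′)
  joined-outer up   down {ℓ} {ℓ′} ℓ<ℓ′ = ℓ′ , inj₂ (right ℓ<ℓ′)
  joined-outer down up   {ℓ} {ℓ′} ℓ<ℓ′ = ℓ′ , inj₂ (left ℓ<ℓ′)
  joined-outer down down {ℓ}      ℓ<ℓ′ = ℓ , inj₁ (right ℓ<ℓ′)

  from-sum : Fin m ⊎ (Fin k ⊎ Fin k) → Vertex
  from-sum (inj₁ i) = inner i
  from-sum (inj₂ (inj₁ ℓ)) = outer up ℓ
  from-sum (inj₂ (inj₂ ℓ)) = outer down ℓ

  as-sum : Vertex → Fin m ⊎ (Fin k ⊎ Fin k)
  as-sum (inner i)      = inj₁ i
  as-sum (outer up ℓ)   = inj₂ (inj₁ ℓ)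
  as-sum (outer down ℓ) = inj₂ (inj₂ ℓ)

  as-from-sum : ∀ a → as-sum (from-sum a) ≡ a
  as-from-sum (inj₁ _)        = refl
  as-from-sum (inj₂ (inj₁ _)) = refl
  as-from-sum (inj₂ (inj₂ _)) = refl

  from-sum-injective : ∀ a b → from-sum a ≡ from-sum b → a ≡ b
  from-sum-injective a b eq = trans (sym (as-from-sum a)) (trans (cong as-sum eq) (as-from-sum b))

  to-sum : Fin (m ℕ.+ (k ℕ.+ k)) → Fin m ⊎ (Fin k ⊎ Fin k)
  to-sum a = map-⊎ (λ i → i) (Fin.splitAt k) (Fin.splitAt m a)

  of-sum : Fin m ⊎ (Fin k ⊎ Fin k) → Fin (m ℕ.+ (k ℕ.+ k))
  of-sum s = Fin.join m (k ℕ.+ k) (map-⊎ (λ i → i) (Fin.join k k) s)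

  of-to-sum : ∀ a → of-sum (to-sum a) ≡ a
  of-to-sum a = trans (cong (Fin.join m (k ℕ.+ k)) (inverse (Fin.splitAt m a))) (Finₚ.join-splitAt m (k ℕ.+ k) a)
    where
    inverse : ∀ s → map-⊎ (λ i → i) (Fin.join k k) (map-⊎ (λ i → i) (Fin.splitAt k) s) ≡ s
    inverse (inj₁ _) = refl
    inverse (inj₂ b) = cong inj₂ (Finₚ.join-splitAt k k b)

  module _ (joined-inner : ∀ {i j : Fin m} → i Fin.< j → Joined (inner i) (inner j)) where

    joined : ∀ u v → u ≢ v → Joined u v
    joined (inner i) (inner j) u≢v with Finₚ.<-cmp i j
    ... | tri< i<j _ _ = joined-inner i<j
    ... | tri≈ _ i≡j _ = contradiction (cong inner i≡j) u≢v
    ... | tri> _ _ j<i = joined-sym (joined-inner j<i)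
    joined (inner i) (outer s ℓ) _ = ℓ , inj₂ (spoke s i)
    joined (outer s ℓ) (inner i) _ = ℓ , inj₁ (spoke s i)
    joined (outer s ℓ) (outer s′ ℓ′) u≢v with Finₚ.<-cmp ℓ ℓ′
    ... | tri< ℓ<ℓ′ _ _ = joined-outer s s′ ℓ<ℓ′
    ... | tri> _ _ ℓ′<ℓ = joined-sym (joined-outer s′ s ℓ′<ℓ)
    ... | tri≈ _ refl _ with s | s′
    ...   | up   | up   = contradiction refl u≢v
    ...   | up   | down = ℓ , inj₁ axis
    ...   | down | up   = ℓ , inj₂ axis
    ...   | down | down = contradiction refl u≢v

    -- Smaller graphs are obtained by dropping points from the full drawing.
    thickness : ∀ {n} → n ℕ.≤ m ℕ.+ (k ℕ.+ k) → Thickness k n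
    thickness {n} n≤m+2k = record
      { place       = pos ∘ vertex
      ; Layer       = λ ℓ a b → Edge ℓ (vertex a) (vertex b)
      ; irreflexive = λ ℓ e a≡b → edge-irreflexive ℓ e (cong vertex a≡b)
      ; complete    = λ a b a≢b → joined (vertex a) (vertex b) (a≢b ∘ vertex-injective)
      ; planar      = λ ℓ → layer-planar ℓ vertex vertex-injective
      }
      where
      vertex : Fin n → Vertex
      vertex a = from-sum (to-sum (Fin.inject≤ a n≤m+2k))
      vertex-injective : ∀ {a b} → vertex a ≡ vertex b → a ≡ b
      vertex-injective {a} {b} eq = Finₚ.inject≤-injective n≤m+2k n≤m+2k a b
        (trans (sym (of-to-sum (Fin.inject≤ a n≤m+2k)))
          (trans (cong of-sum (from-sum-injective _ _ eq)) (of-to-sum (Fin.inject≤ b n≤m+2k))))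

-- Chebyshev sequences

-- With t = 2 cos θ this is sin (nθ) / sin θ.
sine : ℚ → ℕ → ℚ
sine t zero          = 0ℚ
sine t (suc zero)    = 1ℚ
sine t (suc (suc n)) = t * sine t (suc n) - sine t n

ray : ℚ → ℕ → Point2
ray t n = (sine t n , sine t (suc n))

-- Equally spaced points on an ellipse: by gap-formula the chord from index a to index b is parallel to ray (a + b).
ellipse : ℚ → ℕ → Point2
ellipse t n = scale (sine t n) (ray t n)

-- The form is invariant under the step from `(a , b)` to `(b , t * b - a)` of the recurrence.
ray-conic : ∀ t n → quadratic t (ray t n) ≡ 1ℚ
ray-conic t zero = start t
  where
  start : ∀ t → (0ℚ * 0ℚ + 1ℚ * 1ℚ) - t * (0ℚ * 1ℚ) ≡ 1ℚ
  start = solve-∀ ℚ-ring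
ray-conic t (suc n) = trans (step t (sine t n) (sine t (suc n))) (ray-conic t n)
  where
  step : ∀ t a b → (b * b + (t * b - a) * (t * b - a)) - t * (b * (t * b - a)) ≡ (a * a + b * b) - t * (a * b)
  step = solve-∀ ℚ-ring

-- The step of the recurrence is linear of determinant 1, so both indices may be shifted down
-- together. For sines this is the subtraction formula.
det-ray : ∀ t d b → det (ray t (d ℕ.+ b)) (ray t b) ≡ sine t d
det-ray t d zero rewrite ℕₚ.+-identityʳ d = start (sine t d) (sine t (suc d))
  where
  start : ∀ a b → a * 1ℚ - b * 0ℚ ≡ a
  start = solve-∀ ℚ-ring
det-ray t d (suc b) rewrite ℕₚ.+-suc d b =
  trans (shift t (sine t (d ℕ.+ b)) (sine t (suc (d ℕ.+ b))) (sine t b) (sine t (suc b))) (det-ray t d b)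
  where
  shift : ∀ t a a′ b b′ → a′ * (t * b′ - b) - (t * a′ - a) * b′ ≡ a * b′ - a′ * b
  shift = solve-∀ ℚ-ring

sine-suc-+ : ∀ t x y → sine t (suc (x ℕ.+ y)) ≡ sine t (suc x) * sine t (suc y) - sine t x * sine t y
sine-suc-+ t zero y = start (sine t y) (sine t (suc y))
  where
  start : ∀ a b → b ≡ 1ℚ * b - 0ℚ * a
  start = solve-∀ ℚ-ring
sine-suc-+ t (suc x) y = trans (cong (sine t ∘ suc) (sym (ℕₚ.+-suc x y)))
  (trans (sine-suc-+ t x (suc y)) (shift t (sine t x) (sine t (suc x)) (sine t y) (sine t (suc y))))
  where
  shift : ∀ t a a′ b b′ → a′ * (t * b′ - b) - a * b′ ≡ (t * a′ - a) * b′ - a′ * b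
  shift = solve-∀ ℚ-ring

sine-+ : ∀ t x y → sine t (x ℕ.+ y) ≡ (sine t x * sine t (suc y) + sine t (suc x) * sine t y) - t * (sine t x * sine t y)
sine-+ t zero y = start t (sine t y) (sine t (suc y))
  where
  start : ∀ t a b → a ≡ (0ℚ * b + 1ℚ * a) - t * (0ℚ * a)
  start = solve-∀ ℚ-ring
sine-+ t (suc x) y = trans (sine-suc-+ t x y) (regroup t (sine t x) (sine t (suc x)) (sine t y) (sine t (suc y)))
  where
  regroup : ∀ t a a′ b b′ → a′ * b′ - a * b ≡ (a′ * b′ + (t * a′ - a) * b) - t * (a′ * b)
  regroup = solve-∀ ℚ-ring

-- The analogue of sin² x - sin² y = sin (x - y) sin (x + y): the chord from index `a` to index
-- `d + a` is `sine t d` times the ray of the index sum, here paired with a third ray.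
gap-formula : ∀ t d a c → det (ellipse t (d ℕ.+ a)) (ray t c)
  ≡ det (ellipse t a) (ray t c) + sine t d * det (ray t (d ℕ.+ a ℕ.+ a)) (ray t c)
gap-formula t d a c = trans
  (identity t u u′ v v′ (sine t c) (sine t (suc c)))
  (trans
    -- The polynomial identity carries two error terms, each with a factor that vanishes on the
    -- conic.
    (cong₂ (λ α β → (main + (1ℚ - α) * p) - (1ℚ - β) * q) (ray-conic t a) (ray-conic t (d ℕ.+ a)))
    (trans (clean main p q)
      (cong (det (ellipse t a) (ray t c) +_)
        (cong₂ _*_ (det-ray t d a) (cong₂ (λ α β → α * sine t (suc c) - β * sine t c)
          (sym (sine-+ t (d ℕ.+ a) a)) (sym (sine-suc-+ t (d ℕ.+ a) a)))))))
  where
  u u′ v v′ main p q : ℚ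
  u = sine t (d ℕ.+ a)
  u′ = sine t (suc (d ℕ.+ a))
  v = sine t a
  v′ = sine t (suc a)
  main = (v * v * sine t (suc c) - v * v′ * sine t c)
    + (u * v′ - u′ * v) * (((u * v′ + u′ * v) - t * (u * v)) * sine t (suc c) - (u′ * v′ - u * v) * sine t c)
  p = u * u * sine t (suc c) - u * u′ * sine t c
  q = v * v * sine t (suc c) - v * v′ * sine t c
  identity : ∀ t u u′ v v′ c c′ → u * u * c′ - u * u′ * c ≡
    (((v * v * c′ - v * v′ * c) + (u * v′ - u′ * v) * (((u * v′ + u′ * v) - t * (u * v)) * c′ - (u′ * v′ - u * v) * c))
      + (1ℚ - ((v * v + v′ * v′) - t * (v * v′))) * (u * u * c′ - u * u′ * c))
      - (1ℚ - ((u * u + u′ * u′) - t * (u * u′))) * (v * v * c′ - v * v′ * c)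
  identity = solve-∀ ℚ-ring
  clean : ∀ m p q → (m + (1ℚ - 1ℚ) * p) - (1ℚ - 1ℚ) * q ≡ m
  clean = solve-∀ ℚ-ring

-- Chebyshev sequences of small angle

fromℕ : ℕ → ℚ
fromℕ zero    = 0ℚ
fromℕ (suc n) = 1ℚ + fromℕ n

fromℕ-+ : ∀ m n → fromℕ (m ℕ.+ n) ≡ fromℕ m + fromℕ n
fromℕ-+ zero n = sym (ℚₚ.+-identityˡ (fromℕ n))
fromℕ-+ (suc m) n = trans (cong (1ℚ +_) (fromℕ-+ m n)) (sym (ℚₚ.+-assoc 1ℚ (fromℕ m) (fromℕ n)))

fromℕ-* : ∀ m n → fromℕ (m ℕ.* n) ≡ fromℕ m * fromℕ n
fromℕ-* zero n = sym (ℚₚ.*-zeroˡ (fromℕ n))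
fromℕ-* (suc m) n = trans (fromℕ-+ n (m ℕ.* n)) (trans (cong (fromℕ n +_) (fromℕ-* m n)) (regroup (fromℕ m) (fromℕ n)))
  where
  regroup : ∀ m n → n + m * n ≡ (1ℚ + m) * n
  regroup = solve-∀ ℚ-ring

fromℕ-nonNeg : ∀ n → 0ℚ ≤ fromℕ n
fromℕ-nonNeg zero = ℚₚ.≤-refl
fromℕ-nonNeg (suc n) = ℚₚ.<⇒≤ (+-pos-nonNeg 0<1 (fromℕ-nonNeg n))

fromℕ-mono : ∀ {m n} → m ℕ.≤ n → fromℕ m ≤ fromℕ n
fromℕ-mono {n = n} z≤n = fromℕ-nonNeg n
fromℕ-mono (s≤s m≤n) = ℚₚ.+-monoʳ-≤ 1ℚ (fromℕ-mono m≤n)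

reciprocal : ∀ {a} → 0ℚ < a → ∃ λ b → (0ℚ < b) × (b * a ≡ 1ℚ)
reciprocal {a} 0<a = 1/a , ℚₚ.positive⁻¹ 1/a {{ℚₚ.1/pos⇒pos a {{positive 0<a}}}} , ℚₚ.*-inverseˡ a {{≢-nonZero (>⇒≢ 0<a)}}
  where
  1/a : ℚ
  1/a = (1/ a) {{≢-nonZero (>⇒≢ 0<a)}}

-- M plays the role of π / θ.
record HalfTurn (L : ℕ) : Set where
  field
    t        : ℚ
    M        : ℕ
    definite : Definite t
    L<M      : L ℕ.< M
    sine-pos : ∀ {m} → 1 ℕ.≤ m → m ℕ.< M → 0ℚ < sine t m
    sine-neg : ∀ {y} → 1 ℕ.≤ y → suc y ℕ.< M → sine t (M ℕ.+ y) < 0ℚ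

-- `c` is 1 / (1 + L²), so `t = 2 - c` belongs to an angle of about 1 / L, and the sequence needs
-- more than `L` steps to change its sign.
module SmallAngle (L : ℕ) (c : ℚ) (0<c : 0ℚ < c) (c-inverse : c * (1ℚ + fromℕ L * fromℕ L) ≡ 1ℚ) where

  private
    Λ : ℚ
    Λ = fromℕ L

  c≤1 : c ≤ 1ℚ
  c≤1 = ≤-by-difference (*-nonNeg (ℚₚ.<⇒≤ 0<c) (square-nonNeg Λ)) (trans (sym c-inverse) (expand c Λ))
    where
    expand : ∀ c l → c * (1ℚ + l * l) ≡ c + c * (l * l)
    expand = solve-∀ ℚ-ring

  t : ℚ
  t = (1ℚ + 1ℚ) - c

  0<2+t : 0ℚ < (1ℚ + 1ℚ) + t
  0<2+t = subst (0ℚ <_) (regroup c) (+-pos-nonNeg (+-pos 0<1 0<2) (≤⇒0≤- c≤1))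
    where
    regroup : ∀ c → (1ℚ + (1ℚ + 1ℚ)) + (1ℚ - c) ≡ (1ℚ + 1ℚ) + ((1ℚ + 1ℚ) - c)
    regroup = solve-∀ ℚ-ring

  -- Four times the form is (2 + t) (x₁ - x₂)² + (2 - t) (x₁ + x₂)², with both coefficients
  -- positive.
  definite : Definite t
  definite (x₁ , x₂) q≡0 = cong₂ _,_ x₁≡0 (trans (sym (-≡0⇒≡ diff≡0)) x₁≡0)
    where
    squares : ∀ c x₁ x₂ → ((1ℚ + 1ℚ) + ((1ℚ + 1ℚ) - c)) * ((x₁ - x₂) * (x₁ - x₂)) + c * ((x₁ + x₂) * (x₁ + x₂))
      ≡ (1ℚ + 1ℚ) * (1ℚ + 1ℚ) * ((x₁ * x₁ + x₂ * x₂) - ((1ℚ + 1ℚ) - c) * (x₁ * x₂))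
    squares = solve-∀ ℚ-ring
    sum≡0 : ((1ℚ + 1ℚ) + t) * ((x₁ - x₂) * (x₁ - x₂)) + c * ((x₁ + x₂) * (x₁ + x₂)) ≡ 0ℚ
    sum≡0 = trans (squares c x₁ x₂) (trans (cong ((1ℚ + 1ℚ) * (1ℚ + 1ℚ) *_) q≡0) (ℚₚ.*-zeroʳ ((1ℚ + 1ℚ) * (1ℚ + 1ℚ))))
    square-pos : ∀ {a} → a ≢ 0ℚ → 0ℚ < a * a
    square-pos {a} a≢0 with ≢⇒≶ (*-≢0 a≢0 a≢0)
    ... | inj₁ aa<0 = contradiction (ℚₚ.<-≤-trans aa<0 (square-nonNeg a)) (ℚₚ.<-irrefl refl)
    ... | inj₂ 0<aa = 0<aa
    diff≡0 : x₁ - x₂ ≡ 0ℚ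
    diff≡0 with (x₁ - x₂) ℚₚ.≟ 0ℚ
    ... | yes eq = eq
    ... | no ne = contradiction sum≡0 (>⇒≢ (+-pos-nonNeg (*-pos 0<2+t (square-pos ne))
                    (*-nonNeg (ℚₚ.<⇒≤ 0<c) (square-nonNeg (x₁ + x₂)))))
    sum-zero : x₁ + x₂ ≡ 0ℚ
    sum-zero with (x₁ + x₂) ℚₚ.≟ 0ℚ
    ... | yes eq = eq
    ... | no ne = contradiction (trans (ℚₚ.+-comm (c * _) _) sum≡0) (>⇒≢ (+-pos-nonNeg (*-pos 0<c (square-pos ne))
                    (*-nonNeg (ℚₚ.<⇒≤ 0<2+t) (square-nonNeg (x₁ - x₂)))))
    halve : ∀ x₁ x₂ → x₁ * (1ℚ + 1ℚ) ≡ (x₁ - x₂) + (x₁ + x₂)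
    halve = solve-∀ ℚ-ring
    x₁≡0 : x₁ ≡ 0ℚ
    x₁≡0 = *-zero-cancelʳ (>⇒≢ 0<2) (trans (halve x₁ x₂) (cong₂ _+_ diff≡0 sum-zero))

  S : ℕ → ℚ
  S = sine t

  D : ℕ → ℚ
  D n = S (suc n) - S n

  S-step : ∀ n → S (suc n) ≡ S n + D n
  S-step n = add (S n) (S (suc n))
    where
    add : ∀ a b → b ≡ a + (b - a)
    add = solve-∀ ℚ-ring

  D-step : ∀ n → D n ≡ D (suc n) + c * S (suc n)
  D-step n = step c (S n) (S (suc n))
    where
    step : ∀ c a b → b - a ≡ ((((1ℚ + 1ℚ) - c) * b - a) - b) + c * b
    step = solve-∀ ℚ-ring

  -- The increments `D` drop by `c * S`, hence by at most `c * L` per step while `S` is at most `L`.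
  -- So for `n ≤ L` they stay at least 1 - c L², which is `c`.
  record Initial (n : ℕ) : Set where
    field
      S≥0 : 0ℚ ≤ S n
      S≤n : S n ≤ fromℕ n
      D≤1 : D n ≤ 1ℚ
      D≥  : 1ℚ ≤ D n + c * (fromℕ n * Λ)

  open Initial

  D-pos : ∀ {n} → n ℕ.≤ L → Initial n → 0ℚ < D n
  D-pos {n} n≤L init = ℚₚ.<-≤-trans 0<c (≤-by-difference
      (+-nonNeg (≤⇒0≤- (subst (_≤ D n + c * (fromℕ n * Λ)) (sym c-inverse) (D≥ init)))
                (*-nonNeg (ℚₚ.<⇒≤ 0<c) (*-nonNeg (fromℕ-nonNeg L) (≤⇒0≤- (fromℕ-mono n≤L)))))
      (regroup (D n) c (fromℕ n) Λ))
    where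
    regroup : ∀ d c n l → d ≡ c + (((d + c * (n * l)) - c * (1ℚ + l * l)) + c * (l * (l - n)))
    regroup = solve-∀ ℚ-ring

  S-suc-pos : ∀ {n} → n ℕ.≤ L → Initial n → 0ℚ < S (suc n)
  S-suc-pos {n} n≤L init = subst (0ℚ <_) (trans (ℚₚ.+-comm (D n) (S n)) (sym (S-step n)))
    (+-pos-nonNeg (D-pos n≤L init) (S≥0 init))

  initial : ∀ n → n ℕ.≤ L → Initial n
  initial zero _ = record
    { S≥0 = ℚₚ.≤-refl
    ; S≤n = ℚₚ.≤-refl
    ; D≤1 = ℚₚ.≤-refl
    ; D≥  = ℚₚ.≤-reflexive (start c Λ)
    }
    where
    start : ∀ c l → 1ℚ ≡ (1ℚ - 0ℚ) + c * (0ℚ * l)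
    start = solve-∀ ℚ-ring
  initial (suc n) n<L = record
    { S≥0 = S′≥0
    ; S≤n = S′≤n
    ; D≤1 = ℚₚ.≤-trans (≤-by-difference (*-nonNeg (ℚₚ.<⇒≤ 0<c) S′≥0) (D-step n)) (D≤1 previous)
    ; D≥  = ℚₚ.≤-trans (D≥ previous) (≤-by-difference (*-nonNeg (ℚₚ.<⇒≤ 0<c) (≤⇒0≤- (ℚₚ.≤-trans S′≤n (fromℕ-mono n<L))))
              (trans (regroup (D (suc n)) c (fromℕ n) Λ (S (suc n)))
                (cong (λ e → (e + c * (fromℕ n * Λ)) + c * (Λ - S (suc n))) (sym (D-step n)))))
    }
    where
    previous : Initial n
    previous = initial n (ℕₚ.<⇒≤ n<L)
    S′≥0 : 0ℚ ≤ S (suc n)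
    S′≥0 = ℚₚ.<⇒≤ (S-suc-pos (ℕₚ.<⇒≤ n<L) previous)
    S′≤n : S (suc n) ≤ fromℕ (suc n)
    S′≤n = ≤-by-difference (+-nonNeg (≤⇒0≤- (S≤n previous)) (≤⇒0≤- (D≤1 previous))) (bound (fromℕ n) (S n) (S (suc n)))
      where
      bound : ∀ n a b → 1ℚ + n ≡ b + ((n - a) + (1ℚ - (b - a)))
      bound = solve-∀ ℚ-ring
    regroup : ∀ d c n l s → d + c * ((1ℚ + n) * l) ≡ ((d + c * s) + c * (n * l)) + c * (l - s)
    regroup = solve-∀ ℚ-ring

  S-initially-pos : ∀ n → 1 ℕ.≤ n → n ℕ.≤ L → 0ℚ < S n
  S-initially-pos (suc n) _ n<L = S-suc-pos (ℕₚ.<⇒≤ n<L) (initial n (ℕₚ.<⇒≤ n<L))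

  -- The index of the first sign change

  PosUpTo : ℕ → Set
  PosUpTo n = ∀ m → 1 ℕ.≤ m → m ℕ.≤ n → 0ℚ < S m

  FirstNonPos : ℕ → Set
  FirstNonPos M = (1 ℕ.≤ M) × (S M ≤ 0ℚ) × (∀ m → 1 ℕ.≤ m → m ℕ.< M → 0ℚ < S m)

  search : ∀ n → PosUpTo n ⊎ ∃ FirstNonPos
  search zero = inj₁ λ m 1≤m m≤0 → contradiction (ℕₚ.≤-trans 1≤m m≤0) λ ()
  search (suc n) with search n
  ... | inj₂ found = inj₂ found
  ... | inj₁ positive-so-far with ℚₚ.<-cmp 0ℚ (S (suc n))
  ...   | tri< 0<S _ _ = inj₁ λ m 1≤m m≤1+n →
          [ (λ m<1+n → positive-so-far m 1≤m (ℕₚ.≤-pred m<1+n)) , (λ { refl → 0<S }) ]′ (ℕₚ.m≤n⇒m<n∨m≡n m≤1+n)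
  ...   | tri≈ _ 0≡S _ = inj₂ (suc n , s≤s z≤n , ℚₚ.≤-reflexive (sym 0≡S) ,
          λ m 1≤m m≤n → positive-so-far m 1≤m (ℕₚ.≤-pred m≤n))
  ...   | tri> _ _ S<0 = inj₂ (suc n , s≤s z≤n , ℚₚ.<⇒≤ S<0 ,
          λ m 1≤m m≤n → positive-so-far m 1≤m (ℕₚ.≤-pred m≤n))

  -- On the conic, two consecutive nonnegative values have sum at least 1, so D drops by at least c in every two steps.

  sum≥1 : ∀ n → 0ℚ ≤ S n → 0ℚ ≤ S (suc n) → 1ℚ ≤ S n + S (suc n)
  sum≥1 n 0≤a 0≤b with ℚₚ.<-cmp (S n + S (suc n)) 1ℚ
  ... | tri≈ _ eq _ = ℚₚ.≤-reflexive (sym eq)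
  ... | tri> _ _ 1<s = ℚₚ.<⇒≤ 1<s
  ... | tri< s<1 _ _ = contradiction (trans (sym (ray-conic t n)) (expand t a b)) (>⇒≢ (<-by-difference
        (+-pos-nonNeg (*-pos (<⇒0<- s<1) (+-pos-nonNeg 0<1 (+-nonNeg 0≤a 0≤b))) (*-nonNeg (ℚₚ.<⇒≤ 0<2+t) (*-nonNeg 0≤a 0≤b)))
        (cancel ((1ℚ + 1ℚ + t) * (a * b)) (a + b))))
    where
    a b : ℚ
    a = S n
    b = S (suc n)
    expand : ∀ t a b → (a * a + b * b) - t * (a * b) ≡ (a + b) * (a + b) - (1ℚ + 1ℚ + t) * (a * b)
    expand = solve-∀ ℚ-ring
    cancel : ∀ p s → 1ℚ ≡ (s * s - p) + ((1ℚ - s) * (1ℚ + s) + p)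
    cancel = solve-∀ ℚ-ring

  double : ℕ → ℕ
  double zero    = zero
  double (suc j) = suc (suc (double j))

  nonNeg-from-pos : ∀ {n} → PosUpTo n → ∀ m → m ℕ.≤ n → 0ℚ ≤ S m
  nonNeg-from-pos _   zero    _   = ℚₚ.≤-refl
  nonNeg-from-pos pos (suc m) m<n = ℚₚ.<⇒≤ (pos (suc m) (s≤s z≤n) m<n)

  D-drop : ∀ j → PosUpTo (suc (double j)) → D (double j) + c * fromℕ j ≤ 1ℚ
  D-drop zero _ = ℚₚ.≤-reflexive (start c)
    where
    start : ∀ c → (1ℚ - 0ℚ) + c * 0ℚ ≡ 1ℚ
    start = solve-∀ ℚ-ring
  D-drop (suc j) pos = ℚₚ.≤-trans (≤-by-difference (*-nonNeg (ℚₚ.<⇒≤ 0<c) (≤⇒0≤- (sum≥1 (suc n)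
        (nonNeg-from-pos pos (suc n) (ℕₚ.m≤n+m (suc n) 2)) (nonNeg-from-pos pos (suc (suc n)) (ℕₚ.n≤1+n _)))))
        (trans (cong (_+ c * fromℕ j) (trans (D-step n) (cong (_+ c * S (suc n)) (D-step (suc n)))))
          (regroup (D (suc (suc n))) c (fromℕ j) (S (suc n)) (S (suc (suc n))))))
      (D-drop j (λ m 1≤m m≤ → pos m 1≤m (ℕₚ.≤-trans m≤ (ℕₚ.m≤n+m _ 2))))
    where
    n : ℕ
    n = double j
    regroup : ∀ d c j a b → ((d + c * b) + c * a) + c * j ≡ (d + c * (1ℚ + j)) + c * ((a + b) - 1ℚ)
    regroup = solve-∀ ℚ-ring

  -- On the conic the square of `D n` plus `c` times the product of the two values is 1, and that
  -- product is nonnegative here.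
  D≥-1 : ∀ n → 0ℚ ≤ S n → 0ℚ ≤ S (suc n) → ¬ (D n < - 1ℚ)
  D≥-1 n 0≤a 0≤b D<-1 = contradiction (sym (trans (sym (ray-conic t n)) (expand c (S n) (S (suc n)))))
      (>⇒≢ (<-by-difference (+-pos-nonNeg (*-pos (<⇒0<- D<-1) (<⇒0<- (ℚₚ.<-trans D<-1 (ℚₚ.neg<pos (- 1ℚ) 1ℚ))))
        (*-nonNeg (ℚₚ.<⇒≤ 0<c) (*-nonNeg 0≤a 0≤b))) (cancel (D n) (c * (S n * S (suc n))))))
    where
    expand : ∀ c a b → (a * a + b * b) - ((1ℚ + 1ℚ) - c) * (a * b) ≡ (b - a) * (b - a) + c * (a * b)
    expand = solve-∀ ℚ-ring
    cancel : ∀ d p → d * d + p ≡ 1ℚ + ((- 1ℚ - d) * (1ℚ - d) + p)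
    cancel = solve-∀ ℚ-ring

  -- Chosen so that `c * drop-length` is `c + 2`: starting from 1, the increments would fall below
  -- -1.
  drop-length : ℕ
  drop-length = suc (2 ℕ.* suc (L ℕ.* L))

  c*drop-length : c * fromℕ drop-length ≡ c + (1ℚ + 1ℚ)
  c*drop-length = trans
    (cong (λ e → c * (1ℚ + e)) (trans (fromℕ-* 2 (suc (L ℕ.* L))) (cong (λ e → fromℕ 2 * (1ℚ + e)) (fromℕ-* L L))))
    (trans (expand c (1ℚ + Λ * Λ)) (trans (cong (λ e → c + (1ℚ + 1ℚ) * e) c-inverse) (cong (c +_) (ℚₚ.*-identityʳ (1ℚ + 1ℚ)))))
    where
    expand : ∀ c e → c * (1ℚ + (1ℚ + (1ℚ + 0ℚ)) * e) ≡ c + (1ℚ + 1ℚ) * (c * e)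
    expand = solve-∀ ℚ-ring

  not-always-pos : ¬ PosUpTo (suc (double drop-length))
  not-always-pos pos = D≥-1 n (nonNeg-from-pos pos n (ℕₚ.n≤1+n n)) (nonNeg-from-pos pos (suc n) ℕₚ.≤-refl)
      (<-by-difference (+-pos-nonNeg 0<c (≤⇒0≤- (subst (λ e → D n + e ≤ 1ℚ) c*drop-length (D-drop drop-length pos))))
        (regroup (D n) c))
    where
    n : ℕ
    n = double drop-length
    regroup : ∀ d c → - 1ℚ ≡ d + (c + (1ℚ - (d + (c + (1ℚ + 1ℚ)))))
    regroup = solve-∀ ℚ-ring

  firstNonPos : ∃ FirstNonPos
  firstNonPos = [ (λ pos → contradiction pos not-always-pos) , (λ found → found) ]′ (search (suc (double drop-length)))

  M : ℕ
  M = proj₁ firstNonPos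

  S-pos : ∀ {m} → 1 ℕ.≤ m → m ℕ.< M → 0ℚ < S m
  S-pos {m} = proj₂ (proj₂ (proj₂ firstNonPos)) m

  L<M : L ℕ.< M
  L<M = ℕₚ.≰⇒> λ M≤L →
    ℚₚ.<-irrefl refl (ℚₚ.<-≤-trans (S-initially-pos M (proj₁ (proj₂ firstNonPos)) M≤L) (proj₁ (proj₂ (proj₂ firstNonPos))))

  -- In the addition formula at `M = suc m`, the product with the nonpositive factor `S M` is
  -- nonpositive, as `suc y < M` makes `S (suc y)` positive, and the positive product of `S m` and
  -- `S y` is subtracted.
  S-neg : ∀ {y} → 1 ℕ.≤ y → suc y ℕ.< M → S (M ℕ.+ y) < 0ℚ
  S-neg {y} 1≤y 1+y<M = after M refl
    where
    after : ∀ m → M ≡ m → S (m ℕ.+ y) < 0ℚ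
    after zero M≡0 = contradiction (subst (1 ℕ.≤_) M≡0 (proj₁ (proj₂ firstNonPos))) λ ()
    after (suc m) M≡1+m = 0<-⇒<0 (subst (0ℚ <_) (trans (regroup (S (suc m)) (S (suc y)) (S m) (S y))
          (cong -_ (sym (sine-suc-+ t m y))))
      (+-pos-nonNeg
        (*-pos (S-pos (ℕₚ.≤-trans 1≤y (ℕₚ.<⇒≤ y<m)) (subst (m ℕ.<_) (sym M≡1+m) ℕₚ.≤-refl)) (S-pos 1≤y (ℕₚ.<⇒≤ 1+y<M)))
        (*-nonNeg (ℚₚ.neg-antimono-≤ (subst (λ m → S m ≤ 0ℚ) M≡1+m (proj₁ (proj₂ (proj₂ firstNonPos)))))
          (ℚₚ.<⇒≤ (S-pos (s≤s z≤n) 1+y<M)))))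
      where
      y<m : y ℕ.< m
      y<m = ℕₚ.≤-pred (subst (suc y ℕ.<_) M≡1+m 1+y<M)
      regroup : ∀ a b p q → p * q + - a * b ≡ - (a * b - p * q)
      regroup = solve-∀ ℚ-ring

  half-turn : HalfTurn L
  half-turn = record
    { t = t ; M = M ; definite = definite ; L<M = L<M ; sine-pos = S-pos ; sine-neg = S-neg }

halfTurn : ∀ L → HalfTurn L
halfTurn L = let (c , 0<c , c-inverse) = reciprocal (+-pos-nonNeg 0<1 (square-nonNeg (fromℕ L))) in
  SmallAngle.half-turn L c 0<c c-inverse

-- An almost regular polygon

module Polygon (k′ : ℕ) where

  -- There are `H` inner points. `L` is the square of 2H, so that dividing `M` by 2H leaves a
  -- quotient larger than the remainder.
  k H L : ℕ
  k = suc k′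
  H = k ℕ.+ k
  L = (H ℕ.+ H) ℕ.* (H ℕ.+ H)

  module Step (half-turn : HalfTurn L) where

    open HalfTurn half-turn public

    -- `q` is the step of the polygon and `p` half of it; `H` steps make up the half turn `M` except
    -- for the rounding error `r`.
    p r q : ℕ
    p = M DivMod./ (H ℕ.+ H)
    r = M DivMod.% (H ℕ.+ H)
    q = p ℕ.+ p

    M≡r+qH : M ≡ r ℕ.+ q ℕ.* H
    M≡r+qH = trans (DivMod.m≡m%n+[m/n]*n M (H ℕ.+ H)) (cong (r ℕ.+_) (regroup p H))
      where
      regroup : ∀ p h → p ℕ.* (h ℕ.+ h) ≡ (p ℕ.+ p) ℕ.* h
      regroup = ℕ-Solver.solve-∀

    r<p : r ℕ.< p
    r<p = ℕₚ.<-≤-trans (DivMod.m%n<n M (H ℕ.+ H))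
      (subst (ℕ._≤ p) (DivMod.m*n/n≡m (H ℕ.+ H) (H ℕ.+ H)) (DivMod./-monoˡ-≤ (H ℕ.+ H) (ℕₚ.<⇒≤ L<M)))

    qH≤M : q ℕ.* H ℕ.≤ M
    qH≤M = subst (q ℕ.* H ℕ.≤_) (sym M≡r+qH) (ℕₚ.m≤n+m (q ℕ.* H) r)

    1≤p : 1 ℕ.≤ p
    1≤p = ℕₚ.≤-trans (s≤s z≤n) r<p

    p<q : p ℕ.< q
    p<q = subst (ℕ._≤ q) (ℕₚ.+-comm p 1) (ℕₚ.+-monoʳ-≤ p 1≤p)

    below-q* : ∀ {x} e → x ℕ.< q → suc e ℕ.≤ H → q ℕ.* e ℕ.+ x ℕ.< M
    below-q* {x} e x<q e<H = ℕₚ.<-≤-trans (ℕₚ.+-monoʳ-< (q ℕ.* e) x<q)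
      (ℕₚ.≤-trans (ℕₚ.≤-reflexive (trans (ℕₚ.+-comm (q ℕ.* e) q) (sym (ℕₚ.*-suc q e)))) (ℕₚ.≤-trans (ℕₚ.*-monoʳ-≤ q e<H) qH≤M))

    sine-odd-pos : ∀ e → e ℕ.< H → 0ℚ < sine t (q ℕ.* e ℕ.+ p)
    sine-odd-pos e e<H = sine-pos (ℕₚ.≤-trans 1≤p (ℕₚ.m≤n+m p (q ℕ.* e))) (below-q* e p<q e<H)

    sine-even-pos : ∀ d → 1 ℕ.≤ d → d ℕ.< H → 0ℚ < sine t (q ℕ.* d)
    sine-even-pos d 1≤d d<H = sine-pos (ℕₚ.*-mono-≤ (ℕₚ.≤-trans 1≤p (ℕₚ.<⇒≤ p<q)) 1≤d)
      (subst (ℕ._< M) (ℕₚ.+-identityʳ (q ℕ.* d)) (below-q* d (ℕₚ.≤-<-trans z≤n p<q) d<H))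

    -- The index exceeds `M` by `q * e + (p - r)`, which is positive because the rounding error is
    -- less than half a step.
    sine-odd-neg : ∀ e → suc e ℕ.< H → sine t (q ℕ.* (H ℕ.+ e) ℕ.+ p) < 0ℚ
    sine-odd-neg e 1+e<H = subst (λ x → sine t x < 0ℚ) M+y≡ (sine-neg
        (ℕₚ.≤-trans (ℕₚ.m<n⇒0<n∸m r<p) (ℕₚ.m≤n+m (p ℕ.∸ r) (q ℕ.* e)))
        (ℕₚ.≤-<-trans (s≤s (ℕₚ.+-monoʳ-≤ (q ℕ.* e) (ℕₚ.m∸n≤m p r)))
          (ℕₚ.≤-<-trans (ℕₚ.+-monoʳ-< (q ℕ.* e) p<q)
            (subst (ℕ._< M) (trans (ℕₚ.+-identityʳ (q ℕ.* suc e)) (trans (ℕₚ.*-suc q e) (ℕₚ.+-comm q (q ℕ.* e))))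
              (below-q* (suc e) (ℕₚ.≤-<-trans z≤n p<q) 1+e<H)))))
      where
      regroup : ∀ r q h e s → r ℕ.+ q ℕ.* h ℕ.+ (q ℕ.* e ℕ.+ s) ≡ q ℕ.* (h ℕ.+ e) ℕ.+ (r ℕ.+ s)
      regroup = ℕ-Solver.solve-∀
      M+y≡ : M ℕ.+ (q ℕ.* e ℕ.+ (p ℕ.∸ r)) ≡ q ℕ.* (H ℕ.+ e) ℕ.+ p
      M+y≡ = trans (cong (ℕ._+ (q ℕ.* e ℕ.+ (p ℕ.∸ r))) M≡r+qH)
        (trans (regroup r q H e (p ℕ.∸ r)) (cong (q ℕ.* (H ℕ.+ e) ℕ.+_) (ℕₚ.m+[n∸m]≡n (ℕₚ.<⇒≤ r<p))))

    -- The polygon has the vertices ellipse (q i), and the direction of layer ℓ lies halfway between those of the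
    -- chords with index sums 2ℓ and 2ℓ + 1.
    direction : ℕ → ℕ
    direction ℓ = q ℕ.* (ℓ ℕ.+ ℓ) ℕ.+ p

    det-ray-neg : ∀ d b → det (ray t b) (ray t (d ℕ.+ b)) ≡ - sine t d
    det-ray-neg d b = trans (det-antisym (ray t b) (ray t (d ℕ.+ b))) (cong -_ (det-ray t d b))

    -- For a chord with index sum `y`, `Up ℓ y` means that the functional of layer `ℓ` increases
    -- towards the larger index: the ray of index `q * y` is ahead of the direction of the layer by
    -- less than a half turn.
    Up Down : ℕ → ℕ → Set
    Up   ℓ y = (ℓ ℕ.+ ℓ ℕ.< y) × (y ℕ.≤ ℓ ℕ.+ ℓ ℕ.+ H)
    Down ℓ y = (y ℕ.≤ ℓ ℕ.+ ℓ) ⊎ (ℓ ℕ.+ ℓ ℕ.+ H ℕ.< y)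

    up-det : ∀ ℓ y → Up ℓ y → 0ℚ < det (ray t (q ℕ.* y)) (ray t (direction ℓ))
    up-det ℓ y (N<y , y≤N+H) = subst (λ x → 0ℚ < det (ray t x) (ray t (direction ℓ))) index
      (subst (0ℚ <_) (sym (det-ray t (q ℕ.* e ℕ.+ p) (direction ℓ))) (sine-odd-pos e e<H))
      where
      e : ℕ
      e = y ℕ.∸ suc (ℓ ℕ.+ ℓ)
      y≡ : suc (ℓ ℕ.+ ℓ) ℕ.+ e ≡ y
      y≡ = ℕₚ.m+[n∸m]≡n N<y
      e<H : e ℕ.< H
      e<H = ℕₚ.+-cancelˡ-≤ (ℓ ℕ.+ ℓ) (suc e) H (subst (ℕ._≤ ℓ ℕ.+ ℓ ℕ.+ H) (trans (sym y≡) (sym (ℕₚ.+-suc (ℓ ℕ.+ ℓ) e))) y≤N+H)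
      regroup : ∀ p e N → (p ℕ.+ p) ℕ.* e ℕ.+ p ℕ.+ ((p ℕ.+ p) ℕ.* N ℕ.+ p) ≡ (p ℕ.+ p) ℕ.* (1 ℕ.+ N ℕ.+ e)
      regroup = ℕ-Solver.solve-∀
      index : q ℕ.* e ℕ.+ p ℕ.+ direction ℓ ≡ q ℕ.* y
      index = trans (regroup p e (ℓ ℕ.+ ℓ)) (cong (q ℕ.*_) y≡)

    -- The ray either comes before the direction of the layer or is ahead of it by more than a half
    -- turn, but less than a full one.
    down-det : ∀ ℓ y → ℓ ℕ.< k → y ℕ.< H ℕ.+ H → Down ℓ y → det (ray t (q ℕ.* y)) (ray t (direction ℓ)) < 0ℚ
    down-det ℓ y ℓ<k _ (inj₁ y≤N) = subst (λ x → det (ray t (q ℕ.* y)) (ray t x) < 0ℚ) index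
      (subst (_< 0ℚ) (sym (det-ray-neg (q ℕ.* e ℕ.+ p) (q ℕ.* y))) (ℚₚ.neg-antimono-< (sine-odd-pos e e<H)))
      where
      e : ℕ
      e = (ℓ ℕ.+ ℓ) ℕ.∸ y
      e<H : e ℕ.< H
      e<H = ℕₚ.≤-<-trans (ℕₚ.m∸n≤m (ℓ ℕ.+ ℓ) y) (ℕₚ.+-mono-< ℓ<k ℓ<k)
      regroup : ∀ q e p y → q ℕ.* e ℕ.+ p ℕ.+ q ℕ.* y ≡ q ℕ.* (y ℕ.+ e) ℕ.+ p
      regroup = ℕ-Solver.solve-∀
      index : q ℕ.* e ℕ.+ p ℕ.+ q ℕ.* y ≡ direction ℓ
      index = trans (regroup q e p y) (cong (λ N → q ℕ.* N ℕ.+ p) (ℕₚ.m+[n∸m]≡n y≤N))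
    down-det ℓ y ℓ<k y<2H (inj₂ N+H<y) = subst (λ x → det (ray t x) (ray t (direction ℓ)) < 0ℚ) index
      (subst (_< 0ℚ) (sym (det-ray t (q ℕ.* (H ℕ.+ e) ℕ.+ p) (direction ℓ))) (sine-odd-neg e 1+e<H))
      where
      e : ℕ
      e = y ℕ.∸ suc (ℓ ℕ.+ ℓ ℕ.+ H)
      y≡ : suc (ℓ ℕ.+ ℓ ℕ.+ H) ℕ.+ e ≡ y
      y≡ = ℕₚ.m+[n∸m]≡n N+H<y
      1+e<H : suc e ℕ.< H
      1+e<H = ℕₚ.+-cancelˡ-< H (suc e) H (ℕₚ.≤-<-trans
        (subst (H ℕ.+ suc e ℕ.≤_) (trans (rotate (ℓ ℕ.+ ℓ) H e) y≡) (ℕₚ.m≤n+m (H ℕ.+ suc e) (ℓ ℕ.+ ℓ))) y<2H)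
        where
        rotate : ∀ N h e → N ℕ.+ (h ℕ.+ (1 ℕ.+ e)) ≡ 1 ℕ.+ (N ℕ.+ h) ℕ.+ e
        rotate = ℕ-Solver.solve-∀
      regroup : ∀ p h e N → (p ℕ.+ p) ℕ.* (h ℕ.+ e) ℕ.+ p ℕ.+ ((p ℕ.+ p) ℕ.* N ℕ.+ p) ≡ (p ℕ.+ p) ℕ.* (1 ℕ.+ (N ℕ.+ h) ℕ.+ e)
      regroup = ℕ-Solver.solve-∀
      index : q ℕ.* (H ℕ.+ e) ℕ.+ p ℕ.+ direction ℓ ≡ q ℕ.* y
      index = trans (regroup p H e (ℓ ℕ.+ ℓ)) (cong (q ℕ.*_) y≡)

    height : ℕ → ℕ → ℚ
    height ℓ i = det (ellipse t (q ℕ.* i)) (ray t (direction ℓ))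

    height-gap : ∀ ℓ {i j} → i ℕ.≤ j →
      height ℓ j ≡ height ℓ i + sine t (q ℕ.* (j ℕ.∸ i)) * det (ray t (q ℕ.* (i ℕ.+ j))) (ray t (direction ℓ))
    height-gap ℓ {i} {j} i≤j = trans (cong (λ a → det (ellipse t a) (ray t (direction ℓ))) (sym index))
      (trans (gap-formula t (q ℕ.* (j ℕ.∸ i)) (q ℕ.* i) (direction ℓ))
        (cong (λ a → height ℓ i + sine t (q ℕ.* (j ℕ.∸ i)) * det (ray t a) (ray t (direction ℓ)))
          (trans (cong (ℕ._+ q ℕ.* i) index) (trans (ℕₚ.+-comm (q ℕ.* j) (q ℕ.* i)) (sym (ℕₚ.*-distribˡ-+ q i j))))))
      where
      index : q ℕ.* (j ℕ.∸ i) ℕ.+ q ℕ.* i ≡ q ℕ.* j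
      index = trans (sym (ℕₚ.*-distribˡ-+ q (j ℕ.∸ i) i)) (cong (q ℕ.*_) (ℕₚ.m∸n+n≡m i≤j))

    step-pos : ∀ {i j} → i ℕ.< j → j ℕ.< H → 0ℚ < sine t (q ℕ.* (j ℕ.∸ i))
    step-pos {i} {j} i<j j<H = sine-even-pos (j ℕ.∸ i) (ℕₚ.m<n⇒0<n∸m i<j) (ℕₚ.≤-<-trans (ℕₚ.m∸n≤m j i) j<H)

    height-up : ∀ ℓ {i j} → i ℕ.< j → j ℕ.< H → Up ℓ (i ℕ.+ j) → height ℓ i < height ℓ j
    height-up ℓ {i} {j} i<j j<H rising =
      <-by-difference (*-pos (step-pos i<j j<H) (up-det ℓ (i ℕ.+ j) rising)) (height-gap ℓ (ℕₚ.<⇒≤ i<j))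

    height-down : ∀ ℓ {i j} → ℓ ℕ.< k → i ℕ.< j → j ℕ.< H → Down ℓ (i ℕ.+ j) → height ℓ j < height ℓ i
    height-down ℓ {i} {j} ℓ<k i<j j<H falling = <-by-difference
      (*-pos (step-pos i<j j<H) (<0⇒0<- (down-det ℓ (i ℕ.+ j) ℓ<k (ℕₚ.+-mono-< (ℕₚ.<-trans i<j j<H) j<H) falling)))
      (move (height ℓ i) (height ℓ j) (sine t (q ℕ.* (j ℕ.∸ i))) (det (ray t (q ℕ.* (i ℕ.+ j))) (ray t (direction ℓ)))
        (height-gap ℓ (ℕₚ.<⇒≤ i<j)))
      where
      cancel : ∀ a s d → a ≡ (a + s * d) + s * - d
      cancel = solve-∀ ℚ-ring
      move : ∀ a b s d → b ≡ a + s * d → a ≡ b + s * - d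
      move a _ s d refl = cancel a s d

    up-or-down : ∀ ℓ y → Up ℓ y ⊎ Down ℓ y
    up-or-down ℓ y with y ℕ.≤? ℓ ℕ.+ ℓ | y ℕ.≤? ℓ ℕ.+ ℓ ℕ.+ H
    ... | yes y≤N | _ = inj₂ (inj₁ y≤N)
    ... | no y≰N | yes y≤N+H = inj₁ (ℕₚ.≰⇒> y≰N , y≤N+H)
    ... | no _ | no y≰N+H = inj₂ (inj₂ (ℕₚ.≰⇒> y≰N+H))

    height-injective : ∀ ℓ {i j} → ℓ ℕ.< k → i ℕ.< j → j ℕ.< H → height ℓ i ≢ height ℓ j
    height-injective ℓ {i} {j} ℓ<k i<j j<H with up-or-down ℓ (i ℕ.+ j)
    ... | inj₁ rising = <⇒≢ (height-up ℓ i<j j<H rising)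
    ... | inj₂ falling = >⇒≢ (height-down ℓ ℓ<k i<j j<H falling)

    -- Any two polygon vertices are consecutive in some layer

    Consecutive : ℕ → ℕ → ℕ → Set
    Consecutive ℓ i j = ∀ z → z ℕ.< H → z ≢ i → z ≢ j →
      ((height ℓ z < height ℓ i) × (height ℓ z < height ℓ j)) ⊎ ((height ℓ i < height ℓ z) × (height ℓ j < height ℓ z))

    Near : ℕ → ℕ → Set
    Near N s = (N ℕ.≤ s) × (s ℕ.≤ suc N)

    sum-below : ∀ i {j z N} → z ℕ.< H → i ℕ.+ j ℕ.≤ suc N → z ℕ.+ j ℕ.≤ N ℕ.+ H
    sum-below i {j} {z} {N} z<H s≤1+N = ℕₚ.≤-trans (ℕₚ.+-monoʳ-≤ z (ℕₚ.≤-trans (ℕₚ.m≤n+m j i) s≤1+N))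
      (ℕₚ.≤-trans (ℕₚ.≤-reflexive (trans (ℕₚ.+-suc z N) (ℕₚ.+-comm (suc z) N))) (ℕₚ.+-monoʳ-≤ N z<H))

    -- Nearly parallel chords: if the index sum i + j is at a sign change of Up and Down, then i and j are neighbours.

    consecutive-low : ∀ ℓ {i j} → ℓ ℕ.< k → i ℕ.< j → j ℕ.< H → Near (ℓ ℕ.+ ℓ) (i ℕ.+ j) → Consecutive ℓ i j
    consecutive-low ℓ {i} {j} ℓ<k i<j j<H (N≤s , s≤1+N) z z<H z≢i z≢j with ℕₚ.<-cmp z i | ℕₚ.<-cmp z j
    ... | tri≈ _ z≡i _ | _ = contradiction z≡i z≢i
    ... | _ | tri≈ _ z≡j _ = contradiction z≡j z≢j
    ... | tri< z<i _ _ | _ = inj₂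
      ( height-down ℓ ℓ<k z<i (ℕₚ.<-trans i<j j<H) (inj₁ (ℕₚ.≤-trans (ℕₚ.+-monoʳ-≤ z (ℕₚ.<⇒≤ i<j)) z+j≤N))
      , height-down ℓ ℓ<k (ℕₚ.<-trans z<i i<j) j<H (inj₁ z+j≤N) )
      where
      z+j≤N : z ℕ.+ j ℕ.≤ ℓ ℕ.+ ℓ
      z+j≤N = ℕₚ.≤-pred (ℕₚ.<-≤-trans (ℕₚ.+-monoˡ-< j z<i) s≤1+N)
    ... | tri> _ _ i<z | tri< z<j _ _ = inj₁
      ( height-down ℓ ℓ<k i<z z<H (inj₁ (ℕₚ.≤-pred (ℕₚ.<-≤-trans (ℕₚ.+-monoʳ-< i z<j) s≤1+N)))
      , height-up ℓ z<j j<H (ℕₚ.≤-<-trans N≤s (ℕₚ.+-monoˡ-< j i<z) , z+j≤N+H) )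
      where
      z+j≤N+H : z ℕ.+ j ℕ.≤ ℓ ℕ.+ ℓ ℕ.+ H
      z+j≤N+H = sum-below i z<H s≤1+N
    ... | tri> _ _ i<z | tri> _ _ j<z = inj₂
      ( height-up ℓ i<z z<H (ℕₚ.≤-<-trans N≤s (ℕₚ.+-monoʳ-< i j<z) , ℕₚ.≤-trans (ℕₚ.+-monoˡ-≤ z (ℕₚ.<⇒≤ i<j)) j+z≤N+H)
      , height-up ℓ j<z z<H
          (ℕₚ.≤-<-trans N≤s (ℕₚ.<-≤-trans (ℕₚ.+-monoˡ-< j (ℕₚ.<-trans i<j j<z)) (ℕₚ.≤-reflexive (ℕₚ.+-comm z j))) , j+z≤N+H) )
      where
      j+z≤N+H : j ℕ.+ z ℕ.≤ ℓ ℕ.+ ℓ ℕ.+ H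
      j+z≤N+H = ℕₚ.≤-trans (ℕₚ.≤-reflexive (ℕₚ.+-comm j z)) (sum-below i z<H s≤1+N)

    consecutive-high : ∀ ℓ {i j} → ℓ ℕ.< k → i ℕ.< j → j ℕ.< H → Near (ℓ ℕ.+ ℓ ℕ.+ H) (i ℕ.+ j) → Consecutive ℓ i j
    consecutive-high ℓ {i} {j} ℓ<k i<j j<H (N+H≤s , s≤1+N+H) z z<H z≢i z≢j with ℕₚ.<-cmp z i | ℕₚ.<-cmp z j
    ... | tri≈ _ z≡i _ | _ = contradiction z≡i z≢i
    ... | _ | tri≈ _ z≡j _ = contradiction z≡j z≢j
    ... | tri< z<i _ _ | _ = inj₁
      ( height-up ℓ z<i (ℕₚ.<-trans i<j j<H) (ℕₚ.<-≤-trans N<i (ℕₚ.m≤n+m i z) , ℕₚ.≤-trans (ℕₚ.+-monoʳ-≤ z (ℕₚ.<⇒≤ i<j)) z+j≤N+H)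
      , height-up ℓ (ℕₚ.<-trans z<i i<j) j<H (ℕₚ.<-≤-trans N<i (ℕₚ.≤-trans (ℕₚ.<⇒≤ i<j) (ℕₚ.m≤n+m j z)) , z+j≤N+H) )
      where
      N<i : ℓ ℕ.+ ℓ ℕ.< i
      N<i = ℕₚ.+-cancelʳ-< H (ℓ ℕ.+ ℓ) i (ℕₚ.≤-<-trans N+H≤s (ℕₚ.+-monoʳ-< i j<H))
      z+j≤N+H : z ℕ.+ j ℕ.≤ ℓ ℕ.+ ℓ ℕ.+ H
      z+j≤N+H = ℕₚ.≤-pred (ℕₚ.<-≤-trans (ℕₚ.+-monoˡ-< j z<i) s≤1+N+H)
    ... | tri> _ _ i<z | tri< z<j _ _ = inj₂
      ( height-up ℓ i<z z<H (ℕₚ.<-≤-trans N<i (ℕₚ.m≤m+n i z) , ℕₚ.≤-pred (ℕₚ.<-≤-trans (ℕₚ.+-monoʳ-< i z<j) s≤1+N+H))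
      , height-down ℓ ℓ<k z<j j<H (inj₂ (ℕₚ.≤-<-trans N+H≤s (ℕₚ.+-monoˡ-< j i<z))) )
      where
      N<i : ℓ ℕ.+ ℓ ℕ.< i
      N<i = ℕₚ.+-cancelʳ-< H (ℓ ℕ.+ ℓ) i (ℕₚ.≤-<-trans N+H≤s (ℕₚ.+-monoʳ-< i j<H))
    ... | tri> _ _ i<z | tri> _ _ j<z = inj₁
      ( height-down ℓ ℓ<k i<z z<H (inj₂ (ℕₚ.≤-<-trans N+H≤s (ℕₚ.+-monoʳ-< i j<z)))
      , height-down ℓ ℓ<k j<z z<H (inj₂ (ℕₚ.≤-<-trans N+H≤s (ℕₚ.<-≤-trans (ℕₚ.+-monoˡ-< j i<z) (ℕₚ.≤-reflexive (ℕₚ.+-comm z j))))) )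

    near-even : ∀ k s → s ℕ.< k ℕ.+ k → ∃ λ ℓ → (ℓ ℕ.< k) × Near (ℓ ℕ.+ ℓ) s
    near-even zero s ()
    near-even (suc k) zero _ = 0 , s≤s z≤n , z≤n , z≤n
    near-even (suc k) (suc zero) _ = 0 , s≤s z≤n , z≤n , s≤s z≤n
    near-even (suc k) (suc (suc s)) (s≤s s<) with near-even k s (ℕₚ.≤-pred (subst (suc s ℕ.<_) (ℕₚ.+-suc k k) s<))
    ... | ℓ , ℓ<k , N≤s , s≤1+N = suc ℓ , s≤s ℓ<k ,
          subst (λ N → Near N (suc (suc s))) (cong suc (sym (ℕₚ.+-suc ℓ ℓ))) (s≤s (s≤s N≤s) , s≤s (s≤s s≤1+N))

    -- The layer is half of the index sum modulo `H`, rounded down. Sums below `H` sit at the lower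
    -- sign change of that layer, the others at the upper one.
    consecutive-somewhere : ∀ {i j} → i ℕ.< j → j ℕ.< H → ∃ λ ℓ → (ℓ ℕ.< k) × Consecutive ℓ i j
    consecutive-somewhere {i} {j} i<j j<H with (i ℕ.+ j) ℕ.<? H
    ... | yes s<H = let (ℓ , ℓ<k , near) = near-even k (i ℕ.+ j) s<H in ℓ , ℓ<k , consecutive-low ℓ ℓ<k i<j j<H near
    ... | no s≮H = ℓ , ℓ<k , consecutive-high ℓ ℓ<k i<j j<H
            (subst (ℓ ℕ.+ ℓ ℕ.+ H ℕ.≤_) s≡ (ℕₚ.+-monoˡ-≤ H N≤s) , subst (ℕ._≤ suc (ℓ ℕ.+ ℓ ℕ.+ H)) s≡ (ℕₚ.+-monoˡ-≤ H s≤1+N))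
      where
      s≡ : i ℕ.+ j ℕ.∸ H ℕ.+ H ≡ i ℕ.+ j
      s≡ = ℕₚ.m∸n+n≡m (ℕₚ.≮⇒≥ s≮H)
      found : ∃ λ ℓ → (ℓ ℕ.< k) × Near (ℓ ℕ.+ ℓ) (i ℕ.+ j ℕ.∸ H)
      found = near-even k (i ℕ.+ j ℕ.∸ H)
        (ℕₚ.+-cancelʳ-< H _ H (subst (ℕ._< H ℕ.+ H) (sym s≡) (ℕₚ.+-mono-< (ℕₚ.<-trans i<j j<H) j<H)))
      ℓ : ℕ
      ℓ = proj₁ found
      ℓ<k : ℓ ℕ.< k
      ℓ<k = proj₁ (proj₂ found)
      N≤s : ℓ ℕ.+ ℓ ℕ.≤ i ℕ.+ j ℕ.∸ H
      N≤s = proj₁ (proj₂ (proj₂ found))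
      s≤1+N : i ℕ.+ j ℕ.∸ H ℕ.≤ suc (ℓ ℕ.+ ℓ)
      s≤1+N = proj₂ (proj₂ (proj₂ found))

    direction-turn : ∀ {ℓ ℓ′} → ℓ ℕ.< ℓ′ → ℓ′ ℕ.< k → 0ℚ < det (ray t (direction ℓ′)) (ray t (direction ℓ))
    direction-turn {ℓ} {ℓ′} ℓ<ℓ′ ℓ′<k = subst (λ a → 0ℚ < det (ray t a) (ray t (direction ℓ))) index
      (subst (0ℚ <_) (sym (det-ray t (q ℕ.* (d ℕ.+ d)) (direction ℓ)))
        (sine-even-pos (d ℕ.+ d) (ℕₚ.≤-trans (ℕₚ.m<n⇒0<n∸m ℓ<ℓ′) (ℕₚ.m≤m+n d d)) (ℕₚ.+-mono-< d<k d<k)))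
      where
      d : ℕ
      d = ℓ′ ℕ.∸ ℓ
      d<k : d ℕ.< k
      d<k = ℕₚ.≤-<-trans (ℕₚ.m∸n≤m ℓ′ ℓ) ℓ′<k
      regroup : ∀ q d p ℓ → q ℕ.* (d ℕ.+ d) ℕ.+ (q ℕ.* (ℓ ℕ.+ ℓ) ℕ.+ p) ≡ q ℕ.* ((d ℕ.+ ℓ) ℕ.+ (d ℕ.+ ℓ)) ℕ.+ p
      regroup = ℕ-Solver.solve-∀
      index : q ℕ.* (d ℕ.+ d) ℕ.+ direction ℓ ≡ direction ℓ′
      index = trans (regroup q d p ℓ) (cong (λ e → q ℕ.* (e ℕ.+ e) ℕ.+ p) (ℕₚ.m∸n+n≡m (ℕₚ.<⇒≤ ℓ<ℓ′)))

    direction-pos : ∀ {ℓ} → ℓ ℕ.< k → 0ℚ < sine t (direction ℓ)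
    direction-pos {ℓ} ℓ<k = sine-odd-pos (ℓ ℕ.+ ℓ) (ℕₚ.+-mono-< ℓ<k ℓ<k)

-- Sufficiently large scales

Eventually : (ℚ → Set) → Set
Eventually P = ∃ λ R₀ → ∀ R → R₀ ≤ R → P R

-- The premise `0ℚ < α` stays inside the property, so that finitely many such properties can be
-- combined without knowing the signs.
eventually-linear : ∀ α β → Eventually (λ R → 0ℚ < α → β < R * α)
eventually-linear α β with 0ℚ ℚₚ.<? α
... | no α≤0 = 0ℚ , λ _ _ 0<α → contradiction 0<α α≤0
... | yes 0<α with reciprocal 0<α
-- `b` is the reciprocal of `α`; from β / α + 1 on, `R * α` exceeds `β` by at least `α`.
...   | b , _ , b*α≡1 = β * b + 1ℚ , λ R R₀≤R _ → <-by-difference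
          (+-pos-nonNeg 0<α (*-nonNeg (≤⇒0≤- R₀≤R) (ℚₚ.<⇒≤ 0<α)))
          (trans (regroup R α β b) (cong (_+ (α + (R - (β * b + 1ℚ)) * α)) (trans (cong (β *_) b*α≡1) (ℚₚ.*-identityʳ β))))
  where
  regroup : ∀ r α β b → r * α ≡ β * (b * α) + (α + (r - (β * b + 1ℚ)) * α)
  regroup = solve-∀ ℚ-ring

eventually-× : ∀ {P Q} → Eventually P → Eventually Q → Eventually (λ R → P R × Q R)
eventually-× (R₁ , p) (R₂ , q) = R₁ ⊔ R₂ , λ R R₀≤R →
  p R (ℚₚ.≤-trans (ℚₚ.p≤p⊔q R₁ R₂) R₀≤R) , q R (ℚₚ.≤-trans (ℚₚ.p≤q⊔p R₁ R₂) R₀≤R)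

eventually-∀ : ∀ {n} {P : Fin n → ℚ → Set} → (∀ i → Eventually (P i)) → Eventually (λ R → ∀ i → P i R)
eventually-∀ {zero} _ = 0ℚ , λ _ _ ()
eventually-∀ {suc n} {P} ev with eventually-× (ev Fin.zero) (eventually-∀ {n} {P ∘ Fin.suc} (ev ∘ Fin.suc))
... | R₀ , both = R₀ , λ R R₀≤R → λ where
  Fin.zero → proj₁ (both R R₀≤R)
  (Fin.suc i) → proj₂ (both R R₀≤R) i

eventually-sides : ∀ {P : Side → ℚ → Set} → (∀ s → Eventually (P s)) → Eventually (λ R → ∀ s → P s R)
eventually-sides ev with eventually-× (ev up) (ev down)
... | R₀ , both = R₀ , λ R R₀≤R → λ where
  up → proj₁ (both R R₀≤R)
  down → proj₂ (both R R₀≤R)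

eventually-pos : Eventually (0ℚ <_)
eventually-pos = 1ℚ , λ R 1≤R → ℚₚ.<-≤-trans 0<1 1≤R

witness : ∀ {P} → Eventually P → ∃ P
witness (R₀ , holds) = R₀ , holds R₀ ℚₚ.≤-refl

-- Geometric thickness of complete graphs

-- Lowering the polygon puts it on one side of every line TB, so that the edge TB avoids it.
lower : ℚ → Point2 → Point2
lower Λ (x₁ , x₂) = (x₁ , x₂ - Λ)

det-lower : ∀ Λ x y → det (lower Λ x) y ≡ det x y + Λ * proj₁ y
det-lower Λ (x₁ , x₂) (y₁ , y₂) = identity Λ x₁ x₂ y₁ y₂
  where
  identity : ∀ Λ x₁ x₂ y₁ y₂ → x₁ * y₂ - (x₂ - Λ) * y₁ ≡ (x₁ * y₂ - x₂ * y₁) + Λ * y₁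
  identity = solve-∀ ℚ-ring

module Construction (k′ : ℕ) (half-turn : HalfTurn (Polygon.L k′)) where

  open Polygon k′
  open Step half-turn

  w : Fin k → Point2
  w ℓ = ray t (direction (toℕ ℓ))

  turn : ∀ {ℓ ℓ′} → ℓ Fin.< ℓ′ → 0ℚ < det (w ℓ′) (w ℓ)
  turn {ℓ} {ℓ′} ℓ<ℓ′ = direction-turn ℓ<ℓ′ (Finₚ.toℕ<n ℓ′)

  Lowering : ℚ → Set
  Lowering Λ = ∀ (ℓ : Fin k) (i : Fin H) → 0ℚ < sine t (direction (toℕ ℓ)) →
    - height (toℕ ℓ) (toℕ i) < Λ * sine t (direction (toℕ ℓ))

  lowering : ∃ Lowering
  lowering = witness (eventually-∀ λ ℓ → eventually-∀ λ i →
    eventually-linear (sine t (direction (toℕ ℓ))) (- height (toℕ ℓ) (toℕ i)))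

  module Lowered (Λ : ℚ) (large : Lowering Λ) where

    x : Fin H → Point2
    x i = lower Λ (ellipse t (q ℕ.* toℕ i))

    level-x : ∀ ℓ i → det (x i) (w ℓ) ≡ height (toℕ ℓ) (toℕ i) + Λ * sine t (direction (toℕ ℓ))
    level-x ℓ i = det-lower Λ (ellipse t (q ℕ.* toℕ i)) (w ℓ)

    aside : ∀ ℓ i → 0ℚ < det (x i) (w ℓ)
    aside ℓ i = subst (0ℚ <_) (trans (flip (height (toℕ ℓ) (toℕ i)) (Λ * sine t (direction (toℕ ℓ)))) (sym (level-x ℓ i)))
        (<⇒0<- (large ℓ i (direction-pos (Finₚ.toℕ<n ℓ))))
      where
      flip : ∀ a b → b - - a ≡ a + b
      flip = solve-∀ ℚ-ring

    level-mono : ∀ ℓ {i j} → height (toℕ ℓ) (toℕ i) < height (toℕ ℓ) (toℕ j) → det (x i) (w ℓ) < det (x j) (w ℓ)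
    level-mono ℓ {i} {j} i<j = subst₂ _<_ (sym (level-x ℓ i)) (sym (level-x ℓ j))
      (ℚₚ.+-monoˡ-< (Λ * sine t (direction (toℕ ℓ))) i<j)

    height-distinct : ∀ ℓ {i j : Fin H} → i ≢ j → height (toℕ ℓ) (toℕ i) ≢ height (toℕ {k} ℓ) (toℕ j)
    height-distinct ℓ {i} {j} i≢j with ℕₚ.<-cmp (toℕ i) (toℕ j)
    ... | tri< i<j _ _ = height-injective (toℕ ℓ) (Finₚ.toℕ<n ℓ) i<j (Finₚ.toℕ<n j)
    ... | tri≈ _ i≡j _ = contradiction (Finₚ.toℕ-injective i≡j) i≢j
    ... | tri> _ _ j<i = height-injective (toℕ ℓ) (Finₚ.toℕ<n ℓ) j<i (Finₚ.toℕ<n i) ∘ sym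

    generic : ∀ ℓ {i j} → i ≢ j → det (x i) (w ℓ) ≢ det (x j) (w ℓ)
    generic ℓ i≢j with ≢⇒≶ (height-distinct ℓ i≢j)
    ... | inj₁ i<j = <⇒≢ (level-mono ℓ i<j)
    ... | inj₂ j<i = >⇒≢ (level-mono ℓ j<i)

    FarInner FarOuter : ℚ → Set
    FarInner R = ∀ (ℓ : Fin k) (i j : Fin H) →
      (0ℚ < det (x j) (w ℓ) - det (x i) (w ℓ) → det (x i) (x j) < R * (det (x j) (w ℓ) - det (x i) (w ℓ))) ×
      (0ℚ < det (x j) (w ℓ) - det (x i) (w ℓ) → - det (x i) (x j) < R * (det (x j) (w ℓ) - det (x i) (w ℓ)))
    FarOuter R = ∀ (ℓ : Fin k) s (ℓ′ : Fin k) (i : Fin H) → let e = orientate s (w ℓ′) in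
      0ℚ < det e (w ℓ) → det e (x i) - det (w ℓ) (x i) < R * det e (w ℓ)

    radius : ∃ λ R → (0ℚ < R) × FarInner R × FarOuter R
    radius = witness (eventually-× eventually-pos (eventually-×
      (eventually-∀ λ ℓ → eventually-∀ λ i → eventually-∀ λ j →
        eventually-× (eventually-linear (det (x j) (w ℓ) - det (x i) (w ℓ)) (det (x i) (x j)))
                     (eventually-linear (det (x j) (w ℓ) - det (x i) (w ℓ)) (- det (x i) (x j))))
      (eventually-∀ λ ℓ → eventually-sides λ s → eventually-∀ λ ℓ′ → eventually-∀ λ i →
        eventually-linear (det (orientate s (w ℓ′)) (w ℓ)) (det (orientate s (w ℓ′)) (x i) - det (w ℓ) (x i)))))

    module Scaled (R : ℚ) (0<R : 0ℚ < R) (far-inner : FarInner R) (far-outer : FarOuter R) where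

      conic : ∀ ℓ → quadratic t (w ℓ) ≡ 1ℚ
      conic ℓ = ray-conic t (direction (toℕ ℓ))

      far-inner′ : ∀ ℓ i j → det (x i) (w ℓ) < det (x j) (w ℓ) →
        (det (x i) (x j) < R * (det (x j) (w ℓ) - det (x i) (w ℓ))) ×
        (- det (x i) (x j) < R * (det (x j) (w ℓ) - det (x i) (w ℓ)))
      far-inner′ ℓ i j i<j = proj₁ (far-inner ℓ i j) (<⇒0<- i<j) , proj₂ (far-inner ℓ i j) (<⇒0<- i<j)

      open Layers w x R t 0<R turn aside generic far-inner′ far-outer definite conic

      joined-inner : ∀ {i j} → i Fin.< j → Joined (inner i) (inner j)
      joined-inner {i} {j} i<j = ℓ , neighbours ℓ (λ i≡j → ℕₚ.<-irrefl (cong toℕ i≡j) i<j) beside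
        where
        found : ∃ λ ℓ → (ℓ ℕ.< k) × Consecutive ℓ (toℕ i) (toℕ j)
        found = consecutive-somewhere i<j (Finₚ.toℕ<n j)
        ℓ : Fin k
        ℓ = Fin.fromℕ< (proj₁ (proj₂ found))
        consecutive : Consecutive (toℕ ℓ) (toℕ i) (toℕ j)
        consecutive = subst (λ ℓ → Consecutive ℓ (toℕ i) (toℕ j))
          (sym (Finₚ.toℕ-fromℕ< (proj₁ (proj₂ found)))) (proj₂ (proj₂ found))
        beside : ∀ z → z ≢ i → z ≢ j →
          ((level ℓ z < level ℓ i) × (level ℓ z < level ℓ j)) ⊎ ((level ℓ i < level ℓ z) × (level ℓ j < level ℓ z))
        beside z z≢i z≢j = map-⊎
          (λ (a , b) → level-mono ℓ {z} {i} a , level-mono ℓ {z} {j} b)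
          (λ (a , b) → level-mono ℓ {i} {z} a , level-mono ℓ {j} {z} b)
          (consecutive (toℕ z) (Finₚ.toℕ<n z) (z≢i ∘ Finₚ.toℕ-injective) (z≢j ∘ Finₚ.toℕ-injective))

      scaled-thickness : ∀ {n} → n ℕ.≤ H ℕ.+ H → Thickness k n
      scaled-thickness = thickness joined-inner

    lowered-thickness : ∀ {n} → n ℕ.≤ H ℕ.+ H → Thickness k n
    lowered-thickness = let (R , 0<R , far-inner , far-outer) = radius in Scaled.scaled-thickness R 0<R far-inner far-outer

  complete-thickness : ∀ {n} → n ℕ.≤ H ℕ.+ H → Thickness k n
  complete-thickness = Lowered.lowered-thickness (proj₁ lowering) (proj₂ lowering)

-- Linear images of planar drawings

shear : ℚ → ℚ → Point2 → Point2
shear α β (x₁ , x₂) = (x₁ + α * x₂ , x₁ + β * x₂)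

shear-injective : ∀ {α β} → α ≢ β → ∀ {x y} → shear α β x ≡ shear α β y → x ≡ y
shear-injective {α} {β} α≢β {x₁ , x₂} {y₁ , y₂} eq = cong₂ _,_ x₁≡y₁ x₂≡y₂
  where
  eliminate : ∀ α β x₁ x₂ y₁ y₂ →
    (x₂ - y₂) * (α - β) ≡ ((x₁ + α * x₂) - (y₁ + α * y₂)) - ((x₁ + β * x₂) - (y₁ + β * y₂))
  eliminate = solve-∀ ℚ-ring
  self : ∀ a b → (a - a) - (b - b) ≡ 0ℚ
  self = solve-∀ ℚ-ring
  x₂≡y₂ : x₂ ≡ y₂
  x₂≡y₂ = -≡0⇒≡ (*-zero-cancelʳ (α≢β ∘ -≡0⇒≡) (trans (eliminate α β x₁ x₂ y₁ y₂)
    (trans (cong₂ (λ a b → (a - (y₁ + α * y₂)) - (b - (y₁ + β * y₂))) (cong proj₁ eq) (cong proj₂ eq))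
      (self (y₁ + α * y₂) (y₁ + β * y₂)))))
  isolate : ∀ a b → (a + b) - b ≡ a
  isolate = solve-∀ ℚ-ring
  x₁≡y₁ : x₁ ≡ y₁
  x₁≡y₁ = trans (sym (isolate x₁ (α * x₂))) (trans (cong₂ _-_ (cong proj₁ eq) (cong (α *_) x₂≡y₂)) (isolate y₁ (α * y₂)))

-- A linear map preserves weights on segments, so the point of the same weight is a preimage.
onSeg-unshear : ∀ α β {p} a b → OnSeg p (shear α β a) (shear α β b) → ∃ λ p′ → (p ≡ shear α β p′) × OnSeg p′ a b
onSeg-unshear α β a@(a₁ , a₂) b@(b₁ , b₂) (t , 0≤t , t≤1 , p₁≡ , p₂≡) =
  lerp a b t , cong₂ _,_ (trans p₁≡ (linear α a₁ a₂ b₁ b₂ t)) (trans p₂≡ (linear β a₁ a₂ b₁ b₂ t)) , (t , 0≤t , t≤1 , refl , refl)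
  where
  linear : ∀ α a₁ a₂ b₁ b₂ t →
    (a₁ + α * a₂) + t * ((b₁ + α * b₂) - (a₁ + α * a₂)) ≡ (a₁ + t * (b₁ - a₁)) + α * (a₂ + t * (b₂ - a₂))
  linear = solve-∀ ℚ-ring

shear-planar : ∀ {n α β} → α ≢ β → ∀ {place : Fin n → Point2} {E : Fin n → Fin n → Set} →
  StraightLinePlanar n place E → StraightLinePlanar n (shear α β ∘ place) E
shear-planar {n} {α} {β} α≢β {place} {E} (injective , off-edge , crossing-free) =
    (λ u v eq → injective u v (shear-injective α≢β eq))
  , (λ u v z e z≢u z≢v on → off-edge′ u v z e z≢u z≢v (onSeg-unshear α β (place u) (place v) on))
  , (λ u v y z e e′ different p on on′ → crossing-free′ u v y z e e′ different
       (onSeg-unshear α β (place u) (place v) on) (onSeg-unshear α β (place y) (place z) on′))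
  where
  off-edge′ : ∀ u v z → E u v → z ≢ u → z ≢ v →
    ¬ (∃ λ p′ → (shear α β (place z) ≡ shear α β p′) × OnSeg p′ (place u) (place v))
  off-edge′ u v z e z≢u z≢v (p′ , eq , on) =
    off-edge u v z e z≢u z≢v (subst (λ p → OnSeg p (place u) (place v)) (sym (shear-injective α≢β eq)) on)
  crossing-free′ : ∀ u v y z → E u v → E y z → ¬ SameEdge u v y z → ∀ {p} →
    (∃ λ p′ → (p ≡ shear α β p′) × OnSeg p′ (place u) (place v)) →
    (∃ λ p′ → (p ≡ shear α β p′) × OnSeg p′ (place y) (place z)) →
    ((p ≡ shear α β (place u)) ⊎ (p ≡ shear α β (place v))) × ((p ≡ shear α β (place y)) ⊎ (p ≡ shear α β (place z)))
  crossing-free′ u v y z e e′ different (p′ , p≡ , on) (p″ , p≡′ , on′) =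
    let ends = crossing-free u v y z e e′ different p′ on
                 (subst (λ p → OnSeg p (place y) (place z)) (shear-injective α≢β (trans (sym p≡′) p≡)) on′)
        image : ∀ {a} → p′ ≡ a → _ ≡ shear α β a
        image eq = trans p≡ (cong (shear α β) eq)
    in map-⊎ image image (proj₁ ends) , map-⊎ image image (proj₂ ends)

-- Planes are numbered by pairs of coordinates

triangle : ℕ → ℕ
triangle zero    = zero
triangle (suc d) = d ℕ.+ triangle d

-- As `triangle j` is j (j - 1) / 2, this numbers the pairs `i < j` in blocks, the pairs with larger
-- coordinate `j` filling a block of length `j`.
rank : ℕ → ℕ → ℕ
rank i j = i ℕ.+ triangle j

unrank : ∀ d ℓ → ℓ ℕ.< triangle d → ∃ λ i → ∃ λ j → (i ℕ.< j) × (j ℕ.< d) × (rank i j ≡ ℓ)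
unrank (suc d) ℓ ℓ<T with ℓ ℕ.<? triangle d
... | yes ℓ<T′ = let (i , j , i<j , j<d , eq) = unrank d ℓ ℓ<T′ in i , j , i<j , ℕₚ.m<n⇒m<1+n j<d , eq
... | no ℓ≮T′ = ℓ ℕ.∸ triangle d , d
              , ℕₚ.+-cancelʳ-< (triangle d) (ℓ ℕ.∸ triangle d) d (subst (ℕ._< d ℕ.+ triangle d) (sym ℓ≡) ℓ<T)
              , ℕₚ.≤-refl , ℓ≡
  where
  ℓ≡ : ℓ ℕ.∸ triangle d ℕ.+ triangle d ≡ ℓ
  ℓ≡ = ℕₚ.m∸n+n≡m (ℕₚ.≮⇒≥ ℓ≮T′)

fromℕ-strict : ∀ {m n} → m ℕ.< n → fromℕ m < fromℕ n
fromℕ-strict {m} m<n = ℚₚ.<-≤-trans (<-by-difference 0<1 (ℚₚ.+-comm 1ℚ (fromℕ m))) (fromℕ-mono m<n)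

-- The projection to the coordinates `i < j` is the drawing sheared with the distinct coefficients
-- `i` and `j`; that plane takes over the layer numbered `rank i j`.
thickness⇒map : ∀ {n} d → Thickness (triangle (suc (suc d))) n → HasPlaneProjectingMap (K n) (suc (suc d))
thickness⇒map {n} d τ = π , E′ , π-injective , adjacent , covered , drawn
  where
  open Thickness τ
  π : Fin n → Fin (suc (suc d)) → ℚ
  π v i = proj₁ (place v) + fromℕ (toℕ i) * proj₂ (place v)
  E′ : Fin (suc (suc d)) → Fin (suc (suc d)) → Fin n → Fin n → Set
  E′ i j u v = ∃ λ ℓ → (rank (toℕ i) (toℕ j) ≡ toℕ ℓ) × Layer ℓ u v
  -- Coordinates 0 and 1 already determine the planar point; layer 0 exists because the dimension is
  -- at least 2.
  π-injective : ∀ u v → π u ≡ π v → u ≡ v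
  π-injective u v eq = proj₁ (planar Fin.zero) u v (shear-injective {0ℚ} {1ℚ + 0ℚ} (λ ())
    (cong₂ _,_ (cong-app eq Fin.zero) (cong-app eq (Fin.suc Fin.zero))))
  adjacent : ∀ i j u v → E′ i j u v → u ≢ v
  adjacent i j u v (ℓ , _ , e) = irreflexive ℓ e
  covered : ∀ u v → u ≢ v → Σ (Fin (suc (suc d))) λ i → Σ (Fin (suc (suc d))) λ j → (i Fin.< j) × (E′ i j u v ⊎ E′ i j v u)
  covered u v u≢v =
    let (ℓ , e) = complete u v u≢v
        (i , j , i<j , j<D , rank≡) = unrank (suc (suc d)) (toℕ ℓ) (Finₚ.toℕ<n ℓ)
        i<D = ℕₚ.<-trans i<j j<D
        i≡ = Finₚ.toℕ-fromℕ< i<D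
        j≡ = Finₚ.toℕ-fromℕ< j<D
        located = trans (cong₂ rank i≡ j≡) rank≡
    in Fin.fromℕ< i<D , Fin.fromℕ< j<D , subst₂ ℕ._<_ (sym i≡) (sym j≡) i<j
       , map-⊎ (λ e → ℓ , located , e) (λ e → ℓ , located , e) e
  drawn : ∀ i j → i Fin.< j → StraightLinePlanar n (λ v → proj i j (π v)) (E′ i j)
  drawn i j i<j = (λ u v → proj₁ (shear-planar α≢β (planar Fin.zero)) u v)
    , (λ { u v z (ℓ , _ , e) → proj₁ (proj₂ (shear-planar α≢β (planar ℓ))) u v z e })
    -- Both edges belong to the same plane, so their layers have the same number and coincide.
    , (λ { u v y z (ℓ , eq , e) (ℓ′ , eq′ , e′) → proj₂ (proj₂ (shear-planar α≢β (planar ℓ))) u v y z e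
             (subst (λ ℓ → Layer ℓ y z) (Finₚ.toℕ-injective (trans (sym eq′) eq)) e′) })
    where
    α≢β : fromℕ (toℕ i) ≢ fromℕ (toℕ j)
    α≢β = <⇒≢ (fromℕ-strict i<j)

-- The number of vertices and the bound on the dimension

triangle-square : ∀ d → 8 ℕ.* triangle (suc d) ℕ.+ 1 ≡ (2 ℕ.* suc d ℕ.∸ 1) ℕ.^ 2
triangle-square d = trans (eight d) (sym (odd-square d))
  where
  odd-square : ∀ d → (d ℕ.+ (1 ℕ.+ (d ℕ.+ 0))) ℕ.* ((d ℕ.+ (1 ℕ.+ (d ℕ.+ 0))) ℕ.* 1) ≡ 4 ℕ.* (d ℕ.* d ℕ.+ d) ℕ.+ 1
  odd-square = ℕ-Solver.solve-∀
  step : ∀ d T → 8 ℕ.* (1 ℕ.+ d ℕ.+ T) ℕ.+ 1 ≡ 8 ℕ.* (1 ℕ.+ d) ℕ.+ (8 ℕ.* T ℕ.+ 1)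
  step = ℕ-Solver.solve-∀
  square-step : ∀ d → 8 ℕ.* (1 ℕ.+ d) ℕ.+ (4 ℕ.* (d ℕ.* d ℕ.+ d) ℕ.+ 1) ≡ 4 ℕ.* ((1 ℕ.+ d) ℕ.* (1 ℕ.+ d) ℕ.+ (1 ℕ.+ d)) ℕ.+ 1
  square-step = ℕ-Solver.solve-∀
  eight : ∀ d → 8 ℕ.* triangle (suc d) ℕ.+ 1 ≡ 4 ℕ.* (d ℕ.* d ℕ.+ d) ℕ.+ 1
  eight zero = refl
  eight (suc d) = trans (step d (triangle (suc d))) (trans (cong (8 ℕ.* suc d ℕ.+_) (eight d)) (square-step d))

-- By `triangle-square` the hypothesis reads 2 n + 7 ≤ 8 k + 1, which gives n ≤ 4 k, the number of
-- points drawn in `k` layers.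
vertex-bound : ∀ n d → 2 ℕ.* n ℕ.+ 7 ℕ.≤ (2 ℕ.* suc d ℕ.∸ 1) ℕ.^ 2 →
  let k = triangle (suc d) in n ℕ.≤ (k ℕ.+ k) ℕ.+ (k ℕ.+ k)
vertex-bound n d bound = ℕₚ.*-cancelˡ-≤ 2 (ℕₚ.+-cancelʳ-≤ 1 (2 ℕ.* n) _ (ℕₚ.≤-trans
  (ℕₚ.+-monoʳ-≤ (2 ℕ.* n) (s≤s z≤n))
  (ℕₚ.≤-trans bound (ℕₚ.≤-reflexive (trans (sym (triangle-square d)) (regroup (triangle (suc d))))))))
  where
  regroup : ∀ k → 8 ℕ.* k ℕ.+ 1 ≡ 2 ℕ.* ((k ℕ.+ k) ℕ.+ (k ℕ.+ k)) ℕ.+ 1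
  regroup = ℕ-Solver.solve-∀

theorem1 : (n D : ℕ) → IsCeilBound n D → PdimAtMost (K n) D
-- For `D = 1` the bound would read 2 n + 7 ≤ 1.
theorem1 n (suc zero) (_ , bound , _) = contradiction (ℕₚ.≤-trans (ℕₚ.m≤n+m 7 (2 ℕ.* n)) bound) λ { (s≤s ()) }
theorem1 n (suc (suc d)) (_ , bound , _) =
  suc (suc d) , ℕₚ.≤-refl , thickness⇒map d
    (Construction.complete-thickness k′ (halfTurn (Polygon.L k′)) (vertex-bound n (suc d) bound))
  where
  k′ : ℕ
  -- Chosen so that `suc k′` is `triangle (suc (suc d))` by computation.
  k′ = d ℕ.+ triangle (suc d)
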